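{- Let $A$ be an inhabited simple type whose free variables are $X_1,\dots,X_n$. If $A$ is either balanced or negatively non-duplicated, then $\forall X_1\dots\forall X_n.A\equiv_{\mathsf Y}1$.
   Context: **Types.** Types are given by $A,B::=X\mid A\Rightarrow B\mid\forall X.A\mid 0\mid 1\mid A+B\mid A\times B\mid \mu X.A\mid\nu X.A$, where $X$ ranges over type variables and $\mu X.A,\nu X.A$ are allowed only when all occurrences of $X$ in $A$ are positive; types are taken up to renaming of bound variables. An occurrence of a variable is positive if it lies to the left of an even number of arrows, negative otherwise. For a finite list $\langle C_i\rangle_i$, $\langle C_i\rangle_i\Rightarrow B$ denotes $C_1\Rightarrow\dots\Rightarrow C_k\Rightarrow B$ (just $B$ if the list is empty). Empty sums and products are $0$ and $1$. $\exists\vec Y.A$ is shorthand for $\forall Y'.(\forall\vec Y.(A\Rightarrow Y'))\Rightarrow Y'$ with $Y'$ fresh (and is $A$ if $\vec Y$ is empty). All substitutions are capture-avoiding. **The relation $\equiv_{\mathsf Y}$.** It is the smallest congruence on types (equivalence relation compatible with all type constructors) containing: (Y+) $\forall X.\forall\vec Y.\big\langle\forall\vec Z_k.\langle A_{jk}\rangle_{j\in J_k}\Rightarrow X\big\rangle_{k\in K}\Rightarrow B\ \equiv\ \forall\vec Y.B\big[\{\mu X.\}\sum_{k}\exists\vec Z_k.\prod_{j}A_{jk}\,/\,X\big]$, whenever $X$ has only positive occurrences in each $A_{jk}$ and in $B$; (Y−) $\forall X.\forall\vec Y.\big\langle\forall\vec Z_k.X\Rightarrow A_k\big\rangle_{k\in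 K}\Rightarrow B\ \equiv\ \forall\vec Y.B\big[\{\nu X.\}\prod_k\forall\vec Z_k.A_k\,/\,X\big]$, whenever $X$ has only positive occurrences in each $A_k$ and only negative occurrences in $B$; here $\{\mu X.\}$, $\{\nu X.\}$ mean that the binder is written only if $X$ occurs in some $A_{jk}$ (resp. $A_k$); together with the $\beta\eta$-isomorphisms: $A\Rightarrow(B\Rightarrow C)\equiv B\Rightarrow(A\Rightarrow C)$; $\forall X.\forall Y.A\equiv\forall Y.\forall X.A$; $A\equiv\forall X.A$ and $A\Rightarrow\forall X.B\equiv\forall X.(A\Rightarrow B)$ for $X$ not free in $A$; $A\times1\equiv A$; $1\Rightarrow A\equiv A$; associativity and commutativity of $\times$; $(A\times B)\Rightarrow C\equiv A\Rightarrow(B\Rightarrow C)$; $A\Rightarrow(B\times C)\equiv(A\Rightarrow B)\times(A\Rightarrow C)$; $\forall X.(A\times B)\equiv\forall X.A\times\forall X.B$; $A+0\equiv A$; $A\times0\equiv0$; $0\Rightarrow A\equiv1$; associativity and commutativity of $+$; $A\times(B+C)\equiv(A\times B)+(A\times C)$; $(A+B)\Rightarrow C\equiv(A\Rightarrow C)\times(B\Rightarrow C)$; $\mu X.A\equiv\nu X.A\equiv A$ for $X$ not free in $A$; $\mu X.A\equiv A[\mu X.A/X]$; $\nu X.A\equiv A[\nu X.A/X]$. **Simple types.** A simple type is built from variables and $\Rightarrow$ only. It is inhabited if there is a closed simply typed $\lambda$-term of that type. A simple type $A$ is *balanced* if every variable occurring in $A$ occurs exactly once positively and exactly once negatively. It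 is *negatively non-duplicated* if no variable has two negative occurrences in $A$. -}

module Defs where

open import Data.Bool.Base using (if_then_else_)
open import Data.Fin.Base using (Fin; zero; suc; _↑ʳ_)
open import Data.Fin.Properties using (_≟_)
open import Data.Fin.Substitution
  using (Sub; Lift; TermSubst; module VarSubst; module TermSubst)
open import Data.List.Base using (List; []; _∷_; map; foldr)
open import Data.List.Membership.Propositional using (_∈_)
open import Data.List.Relation.Unary.All using (All)
open import Data.Nat.Base using (ℕ; zero; suc; _+_; _≤_; _<_)
open import Data.Nat.Properties using (_<?_)
open import Data.Product.Base using (Σ-syntax; _×_; _,_)
open import Data.Sign.Base as Sign using (Sign; opposite)
open import Data.Sign.Properties using () renaming (_≟_ to _≟ˢ_)
open import Data.Vec.Base using (_∷_; lookup)
open import Relation.Binary.PropositionalEquality using (_≡_)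
open import Relation.Nullary.Decidable using (Dec; does; _×-dec_)

infixr 5 _⇒_ _⇛_
infixr 6 _⊕_
infixr 7 _⊗_
infix  4 _~_ _≡Y_ _⊢_

-- Pretypes over the type variables Fin n, as de Bruijn terms; the positivity
-- condition on μ and ν is imposed separately, by WF below.

data Ty (n : ℕ) : Set where
  var     : Fin n → Ty n
  _⇒_     : Ty n → Ty n → Ty n
  ∀′      : Ty (suc n) → Ty n
  𝟘 𝟙     : Ty n
  _⊕_ _⊗_ : Ty n → Ty n → Ty n
  μ ν     : Ty (suc n) → Ty n

module TyApp {T : ℕ → Set} (l : Lift T Ty) where
  open Lift l hiding (var)

  infixl 8 _/_

  _/_ : ∀ {m n} → Ty m → Sub T m n → Ty n
  var x   / ρ = lift (lookup ρ x)
  (A ⇒ B) / ρ = (A / ρ) ⇒ (B / ρ)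
  ∀′ A    / ρ = ∀′ (A / ρ ↑)
  𝟘       / ρ = 𝟘
  𝟙       / ρ = 𝟙
  (A ⊕ B) / ρ = (A / ρ) ⊕ (B / ρ)
  (A ⊗ B) / ρ = (A / ρ) ⊗ (B / ρ)
  μ A     / ρ = μ (A / ρ ↑)
  ν A     / ρ = ν (A / ρ ↑)

tySubst : TermSubst Ty
tySubst = record { var = var ; app = TyApp._/_ }

open TermSubst tySubst public using (_/_; _/Var_; weaken; sub)

-- The number of free occurrences of a variable that are positive (Sign.+) or
-- negative (Sign.-).

occ : ∀ {n} → Sign → Fin n → Ty n → ℕ
occ s x (var y) = if does (s ≟ˢ Sign.+ ×-dec x ≟ y) then 1 else 0
occ s x (A ⇒ B) = occ (opposite s) x A + occ s x B
occ s x (∀′ A)  = occ s (suc x) A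
occ s x 𝟘       = 0
occ s x 𝟙       = 0
occ s x (A ⊕ B) = occ s x A + occ s x B
occ s x (A ⊗ B) = occ s x A + occ s x B
occ s x (μ A)   = occ s (suc x) A
occ s x (ν A)   = occ s (suc x) A

Occurs OnlyPositive OnlyNegative : ∀ {n} → Fin n → Ty n → Set
Occurs       x A = 0 < occ Sign.+ x A + occ Sign.- x A
OnlyPositive x A = occ Sign.- x A ≡ 0
OnlyNegative x A = occ Sign.+ x A ≡ 0

occurs? : ∀ {n} (x : Fin n) (A : Ty n) → Dec (Occurs x A)
occurs? x A = 0 <? occ Sign.+ x A + occ Sign.- x A

-- A type, in the sense of the mathematics, is an A : Ty n with WF A.

data WF {n : ℕ} : Ty n → Set where
  var : ∀ x → WF (var x)
  _⇒_ : ∀ {A B} → WF A → WF B → WF (A ⇒ B)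
  ∀′  : ∀ {A} → WF A → WF (∀′ A)
  𝟘   : WF 𝟘
  𝟙   : WF 𝟙
  _⊕_ : ∀ {A B} → WF A → WF B → WF (A ⊕ B)
  _⊗_ : ∀ {A B} → WF A → WF B → WF (A ⊗ B)
  μ   : ∀ {A} → OnlyPositive zero A → WF A → WF (μ A)
  ν   : ∀ {A} → OnlyPositive zero A → WF A → WF (ν A)

_⇛_ : ∀ {n} → List (Ty n) → Ty n → Ty n
Cs ⇛ B = foldr _⇒_ B Cs

∑ ∏ : ∀ {n} → List (Ty n) → Ty n
∑ []           = 𝟘
∑ (A ∷ [])     = A
∑ (A ∷ B ∷ As) = A ⊕ ∑ (B ∷ As)
∏ []           = 𝟙
∏ (A ∷ [])     = A
∏ (A ∷ B ∷ As) = A ⊗ ∏ (B ∷ As)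

∀⋆ : ∀ m {n} → Ty (m + n) → Ty n
∀⋆ zero    A = A
∀⋆ (suc m) A = ∀⋆ m (∀′ A)

∀-closure : ∀ {n} → Ty n → Ty 0
∀-closure {zero}  A = A
∀-closure {suc n} A = ∀-closure (∀′ A)

-- The second-order encoding; the fresh Y′ is bound outside the m quantified
-- variables, so it is variable m in their scope.

∃⋆ : ∀ m {n} → Ty (m + n) → Ty n
∃⋆ zero      A = A
∃⋆ m@(suc _) A = ∀′ (∀⋆ m (A /Var (VarSubst.wk VarSubst.↑⋆ m) ⇒ var (m ↑ʳ zero)) ⇒ var zero)

-- The optional binders {μX.} and {νX.}: when X does not occur, it is removed
-- from the scope by substituting a dummy closed type for it.

μ? ν? : ∀ {n} → Ty (suc n) → Ty n
μ? A = if does (occurs? zero A) then μ A else A / sub 𝟘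
ν? A = if does (occurs? zero A) then ν A else A / sub 𝟘

-- Moves variable 0 past the next m variables.

pull : ∀ m {n} → Sub Fin (suc (m + n)) (m + suc n)
pull m = (m ↑ʳ zero) ∷ (VarSubst.wk VarSubst.↑⋆ m)

-- (z , ⟨A_j⟩) stands for the premise ∀Z₁…Z_z. ⟨A_j⟩ ⇒ X of (Y+), and (z , A)
-- for the premise ∀Z₁…Z_z. X ⇒ A of (Y−), where X is variable 0 of Ty (suc n),
-- hence variable z under the Z's.

Premise⁺ Premise⁻ : ℕ → Set
Premise⁺ n = Σ[ z ∈ ℕ ] List (Ty (z + suc n))
Premise⁻ n = Σ[ z ∈ ℕ ] Ty (z + suc n)

premise⁺ summand : ∀ {n} → Premise⁺ n → Ty (suc n)
premise⁺ (z , As) = ∀⋆ z (As ⇛ var (z ↑ʳ zero))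
summand  (z , As) = ∃⋆ z (∏ As)

premise⁻ factor : ∀ {n} → Premise⁻ n → Ty (suc n)
premise⁻ (z , A) = ∀⋆ z (var (z ↑ʳ zero) ⇒ A)
factor   (z , A) = ∀⋆ z A

Positive⁺ : ∀ {n} → Premise⁺ n → Set
Positive⁺ (z , As) = All (OnlyPositive (z ↑ʳ zero)) As

Positive⁻ : ∀ {n} → Premise⁻ n → Set
Positive⁻ (z , A) = OnlyPositive (z ↑ʳ zero) A

-- In Y+ and Y−, X is variable 0 of the premises and of B, and the m Y's are
-- variables 1 to m; pull moves X outside the Y's, as in ∀X.∀Y₁…Y_m.  Elsewhere,
-- "X not free in A" is expressed by weakening A.

data _~_ {n : ℕ} : Ty n → Ty n → Set where
  Y+ : ∀ m (Ks : List (Premise⁺ (m + n))) (B : Ty (suc (m + n))) →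
       All Positive⁺ Ks → OnlyPositive zero B →
       ∀′ (∀⋆ m ((map premise⁺ Ks ⇛ B) /Var pull m))
         ~ ∀⋆ m (B / sub (μ? (∑ (map summand Ks))))
  Y− : ∀ m (Ks : List (Premise⁻ (m + n))) (B : Ty (suc (m + n))) →
       All Positive⁻ Ks → OnlyNegative zero B →
       ∀′ (∀⋆ m ((map premise⁻ Ks ⇛ B) /Var pull m))
         ~ ∀⋆ m (B / sub (ν? (∏ (map factor Ks))))

  ⇒-swap : ∀ A B C → A ⇒ (B ⇒ C) ~ B ⇒ (A ⇒ C)
  ∀-swap : ∀ A → ∀′ (∀′ A) ~ ∀′ (∀′ (A /Var pull 1))
  ∀-void : ∀ A → A ~ ∀′ (weaken A)
  ⇒-∀    : ∀ A B → A ⇒ ∀′ B ~ ∀′ (weaken A ⇒ B)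

  ⊗-identityʳ : ∀ A → A ⊗ 𝟙 ~ A
  𝟙-⇒         : ∀ A → 𝟙 ⇒ A ~ A
  ⊗-assoc     : ∀ A B C → (A ⊗ B) ⊗ C ~ A ⊗ (B ⊗ C)
  ⊗-comm      : ∀ A B → A ⊗ B ~ B ⊗ A
  ⊗-⇒         : ∀ A B C → (A ⊗ B) ⇒ C ~ A ⇒ (B ⇒ C)
  ⇒-⊗         : ∀ A B C → A ⇒ (B ⊗ C) ~ (A ⇒ B) ⊗ (A ⇒ C)
  ∀-⊗         : ∀ A B → ∀′ (A ⊗ B) ~ ∀′ A ⊗ ∀′ B
  ⊕-identityʳ : ∀ A → A ⊕ 𝟘 ~ A
  ⊗-zeroʳ     : ∀ A → A ⊗ 𝟘 ~ 𝟘
  𝟘-⇒         : ∀ A → 𝟘 ⇒ A ~ 𝟙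
  ⊕-assoc     : ∀ A B C → (A ⊕ B) ⊕ C ~ A ⊕ (B ⊕ C)
  ⊕-comm      : ∀ A B → A ⊕ B ~ B ⊕ A
  ⊗-distrib-⊕ : ∀ A B C → A ⊗ (B ⊕ C) ~ (A ⊗ B) ⊕ (A ⊗ C)
  ⊕-⇒         : ∀ A B C → (A ⊕ B) ⇒ C ~ (A ⇒ C) ⊗ (B ⇒ C)

  μ-void   : ∀ A → μ (weaken A) ~ A
  ν-void   : ∀ A → ν (weaken A) ~ A
  μ-unfold : ∀ A → μ A ~ A / sub (μ A)
  ν-unfold : ∀ A → ν A ~ A / sub (ν A)

-- The smallest congruence on types containing _~_.  Every A ≡Y B relates types
-- only: both A and B satisfy WF.

data _≡Y_ {n : ℕ} : Ty n → Ty n → Set where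
  axiom    : ∀ {A B} → WF A → WF B → A ~ B → A ≡Y B
  ≡Y-refl  : ∀ {A} → WF A → A ≡Y A
  ≡Y-sym   : ∀ {A B} → A ≡Y B → B ≡Y A
  ≡Y-trans : ∀ {A B C} → A ≡Y B → B ≡Y C → A ≡Y C
  ⇒-cong   : ∀ {A A′ B B′} → A ≡Y A′ → B ≡Y B′ → A ⇒ B ≡Y A′ ⇒ B′
  ∀-cong   : ∀ {A A′} → A ≡Y A′ → ∀′ A ≡Y ∀′ A′
  ⊕-cong   : ∀ {A A′ B B′} → A ≡Y A′ → B ≡Y B′ → A ⊕ B ≡Y A′ ⊕ B′
  ⊗-cong   : ∀ {A A′ B B′} → A ≡Y A′ → B ≡Y B′ → A ⊗ B ≡Y A′ ⊗ B′
  μ-cong   : ∀ {A A′} → OnlyPositive zero A → OnlyPositive zero A′ →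
             A ≡Y A′ → μ A ≡Y μ A′
  ν-cong   : ∀ {A A′} → OnlyPositive zero A → OnlyPositive zero A′ →
             A ≡Y A′ → ν A ≡Y ν A′

data Simple (n : ℕ) : Set where
  var : Fin n → Simple n
  _⇒_ : Simple n → Simple n → Simple n

⌜_⌝ : ∀ {n} → Simple n → Ty n
⌜ var x ⌝ = var x
⌜ A ⇒ B ⌝ = ⌜ A ⌝ ⇒ ⌜ B ⌝

-- Simply typed λ-terms, intrinsically typed.

data _⊢_ {n : ℕ} (Γ : List (Simple n)) : Simple n → Set where
  var : ∀ {A} → A ∈ Γ → Γ ⊢ A
  ƛ   : ∀ {A B} → A ∷ Γ ⊢ B → Γ ⊢ A ⇒ B
  _·_ : ∀ {A B} → Γ ⊢ A ⇒ B → Γ ⊢ A → Γ ⊢ B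

Inhabited Balanced NegativelyNonDuplicated : ∀ {n} → Simple n → Set
Inhabited A = [] ⊢ A
Balanced A =
  ∀ x → Occurs x ⌜ A ⌝ → occ Sign.+ x ⌜ A ⌝ ≡ 1 × occ Sign.- x ⌜ A ⌝ ≡ 1
NegativelyNonDuplicated A = ∀ x → occ Sign.- x ⌜ A ⌝ ≤ 1

-- Only the absence of duplicated negative occurrences matters.  Eliminating the
-- goal variable X of an inhabited A directly can get stuck: X may also occur in
-- parts of A that no inhabitant visits, and (Y+) then copies negative
-- occurrences into these parts or creates a μ-type.  So every subformula is
-- first given a name by reading (Y+) and (Y−) backwards, which turns A into a
-- set of clauses of order at most two, each variable heading at most one of
-- them.  Proof search is then deterministic, so a derivation of the goal visits
-- no variable twice on a path.  The clauses whose heads are not visited are all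
-- at top level; eliminating their heads one after the other makes them vanish,
-- even when they depend on each other cyclically, since nothing else mentions
-- these heads.  After that the goal occurs positively nowhere else and can be
-- replaced by the product of its subgoals; the quantifiers distribute over that
-- product, and each factor has a shorter derivation.

module Submission where

open import Defs
open import Data.Bool.Base using (if_then_else_; false; true)
open import Data.Empty using (⊥)
open import Data.Fin.Base using (Fin; zero; suc)
open import Data.Fin.Properties using (_≟_)
open import Data.Fin.Substitution using (Sub; module VarSubst; module TermSubst)
open import Data.Fin.Substitution.Lemmas using (module VarLemmas)
open import Data.List.Base using (List; []; _∷_; _++_; map; filter)
open import Data.List.Membership.DecPropositional using (_∈?_)
open import Data.List.Membership.Propositional using (_∈_; _∉_)
open import Data.List.Membership.Propositional.Properties
  using (∈-++⁺ˡ; ∈-++⁺ʳ; ∈-++⁻; ∈-map⁺; ∈-map⁻; ∈-∃++; ∈-filter⁺; ∈-filter⁻)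
import Data.List.Properties as List
open import Data.List.Relation.Binary.Permutation.Propositional as ↭
  using (_↭_; prep; swap; ↭-refl; ↭-sym; ↭-trans)
import Data.List.Relation.Binary.Permutation.Propositional.Properties as ↭
open import Data.List.Relation.Unary.All as All using (All; []; _∷_)
import Data.List.Relation.Unary.All.Properties as All
open import Data.List.Relation.Unary.AllPairs using ([]; _∷_)
open import Data.List.Relation.Unary.Any using (here; there)
open import Data.List.Relation.Unary.Unique.Propositional using (Unique)
open import Data.Nat.Base
  using (ℕ; zero; suc; _+_; _≤_; _≤′_; _⊔_; s≤s; ≤′-refl; ≤′-step)
open import Data.Nat.ListAction using (sum)
open import Data.Nat.ListAction.Properties using (sum-↭)
import Data.Nat.Properties as ℕ
open import Data.Nat.Tactic.RingSolver using (solve-∀)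
open import Data.Product.Base using (_×_; _,_; proj₁; proj₂; ∃; ∃-syntax)
open import Data.Sign.Base as Sign using (Sign; opposite)
open import Data.Sum.Base as Sum using (_⊎_; inj₁; inj₂)
open import Data.Vec.Base as Vec using (Vec; lookup; tabulate; _∷_)
open import Data.Vec.Properties
  using (lookup-map; lookup∘tabulate; tabulate∘lookup; tabulate-cong)
open import Function.Base using (_∘_; id)
open import Induction.WellFounded using (Acc; acc; acc⇒asym)
open import Relation.Binary.Construct.Closure.Transitive
  using (TransClosure; [_]; _∷_; accessible) renaming (_++_ to _◅◅_)
open import Relation.Binary.PropositionalEquality
open import Relation.Nullary.Decidable using (does; yes; no; ¬?; dec-true; dec-false)
open import Relation.Nullary.Negation using (contradiction)
open import Relation.Unary using (Decidable)

-- Renaming and substitution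

-- The hypothesis makes `x` the only preimage of `y`. It equates Booleans because `does` commutes
-- with `suc` by computation, so it passes under binders.
occ-ren : ∀ {m n} s {y : Fin n} {x : Fin m} A {ρ : Sub Fin m n} →
          (∀ z → does (y ≟ lookup ρ z) ≡ does (x ≟ z)) →
          occ s y (A /Var ρ) ≡ occ s x A

occ-ren-↑ : ∀ {m n} s {y : Fin n} {x : Fin m} (A : Ty (suc m)) {ρ : Sub Fin m n} →
            (∀ z → does (y ≟ lookup ρ z) ≡ does (x ≟ z)) →
            occ s (suc y) (A /Var ρ VarSubst.↑) ≡ occ s (suc x) A
occ-ren-↑ s {y} {x} A {ρ} h = occ-ren s A λ where
  zero    → refl
  (suc z) → trans (cong (λ i → does (suc y ≟ i)) (lookup-map z suc ρ)) (h z)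

occ-ren Sign.+ (var z) h = cong (if_then 1 else 0) (h z)
occ-ren Sign.- (var z) h = refl
occ-ren s (A ⇒ B) h = cong₂ _+_ (occ-ren (opposite s) A h) (occ-ren s B h)
occ-ren s (∀′ A)  h = occ-ren-↑ s A h
occ-ren s 𝟘       h = refl
occ-ren s 𝟙       h = refl
occ-ren s (A ⊕ B) h = cong₂ _+_ (occ-ren s A h) (occ-ren s B h)
occ-ren s (A ⊗ B) h = cong₂ _+_ (occ-ren s A h) (occ-ren s B h)
occ-ren s (μ A)   h = occ-ren-↑ s A h
occ-ren s (ν A)   h = occ-ren-↑ s A h

occ-ren-∉ : ∀ {m n} s {y : Fin n} A {ρ : Sub Fin m n} →
            (∀ z → does (y ≟ lookup ρ z) ≡ false) →
            occ s y (A /Var ρ) ≡ 0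

occ-ren-∉-↑ : ∀ {m n} s {y : Fin n} (A : Ty (suc m)) {ρ : Sub Fin m n} →
              (∀ z → does (y ≟ lookup ρ z) ≡ false) →
              occ s (suc y) (A /Var ρ VarSubst.↑) ≡ 0
occ-ren-∉-↑ s {y} A {ρ} h = occ-ren-∉ s A λ where
  zero    → refl
  (suc z) → trans (cong (λ i → does (suc y ≟ i)) (lookup-map z suc ρ)) (h z)

occ-ren-∉ Sign.+ (var z) h = cong (if_then 1 else 0) (h z)
occ-ren-∉ Sign.- (var z) h = refl
occ-ren-∉ s (A ⇒ B) h = cong₂ _+_ (occ-ren-∉ (opposite s) A h) (occ-ren-∉ s B h)
occ-ren-∉ s (∀′ A)  h = occ-ren-∉-↑ s A h
occ-ren-∉ s 𝟘       h = refl
occ-ren-∉ s 𝟙       h = refl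
occ-ren-∉ s (A ⊕ B) h = cong₂ _+_ (occ-ren-∉ s A h) (occ-ren-∉ s B h)
occ-ren-∉ s (A ⊗ B) h = cong₂ _+_ (occ-ren-∉ s A h) (occ-ren-∉ s B h)
occ-ren-∉ s (μ A)   h = occ-ren-∉-↑ s A h
occ-ren-∉ s (ν A)   h = occ-ren-∉-↑ s A h

occ-weaken : ∀ {n} s (x : Fin n) A → occ s (suc x) (weaken A) ≡ occ s x A
occ-weaken s x A = occ-ren s A λ z →
  cong (λ i → does (suc x ≟ i)) (VarLemmas.lookup-wk z)

occ-weaken-zero : ∀ {n} s (A : Ty n) → occ s zero (weaken A) ≡ 0
occ-weaken-zero s A = occ-ren-∉ s A λ z →
  cong (λ i → does (zero ≟ i)) (VarLemmas.lookup-wk z)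

ren-id : ∀ {n} A {ρ : Sub Fin n n} → (∀ x → lookup ρ x ≡ x) → A /Var ρ ≡ A

ren-id-↑ : ∀ {n} (A : Ty (suc n)) {ρ : Sub Fin n n} → (∀ x → lookup ρ x ≡ x) →
           A /Var ρ VarSubst.↑ ≡ A
ren-id-↑ A {ρ} h = ren-id A λ where
  zero    → refl
  (suc x) → trans (lookup-map x suc ρ) (cong suc (h x))

ren-id (var x) h = cong var (h x)
ren-id (A ⇒ B) h = cong₂ _⇒_ (ren-id A h) (ren-id B h)
ren-id (∀′ A)  h = cong ∀′ (ren-id-↑ A h)
ren-id 𝟘       h = refl
ren-id 𝟙       h = refl
ren-id (A ⊕ B) h = cong₂ _⊕_ (ren-id A h) (ren-id B h)
ren-id (A ⊗ B) h = cong₂ _⊗_ (ren-id A h) (ren-id B h)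
ren-id (μ A)   h = cong μ (ren-id-↑ A h)
ren-id (ν A)   h = cong ν (ren-id-↑ A h)

ren-ren : ∀ {m n o} A {ρ : Sub Fin m n} {ρ′ : Sub Fin n o} {τ : Sub Fin m o} →
          (∀ x → lookup ρ′ (lookup ρ x) ≡ lookup τ x) →
          A /Var ρ /Var ρ′ ≡ A /Var τ

ren-ren-↑ : ∀ {m n o} (A : Ty (suc m)) {ρ : Sub Fin m n} {ρ′ : Sub Fin n o}
            {τ : Sub Fin m o} → (∀ x → lookup ρ′ (lookup ρ x) ≡ lookup τ x) →
            A /Var ρ VarSubst.↑ /Var ρ′ VarSubst.↑ ≡ A /Var τ VarSubst.↑
ren-ren-↑ A {ρ} {ρ′} {τ} h = ren-ren A λ where
  zero    → refl
  (suc x) → trans (cong (lookup (ρ′ VarSubst.↑)) (lookup-map x suc ρ))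
           (trans (lookup-map (lookup ρ x) suc ρ′)
           (trans (cong suc (h x)) (sym (lookup-map x suc τ))))

ren-ren (var x) h = cong var (h x)
ren-ren (A ⇒ B) h = cong₂ _⇒_ (ren-ren A h) (ren-ren B h)
ren-ren (∀′ A)  h = cong ∀′ (ren-ren-↑ A h)
ren-ren 𝟘       h = refl
ren-ren 𝟙       h = refl
ren-ren (A ⊕ B) h = cong₂ _⊕_ (ren-ren A h) (ren-ren B h)
ren-ren (A ⊗ B) h = cong₂ _⊗_ (ren-ren A h) (ren-ren B h)
ren-ren (μ A)   h = cong μ (ren-ren-↑ A h)
ren-ren (ν A)   h = cong ν (ren-ren-↑ A h)

infix 10 _⇑

_⇑ : ∀ {m n} → Sub Ty m n → Sub Ty (suc m) (suc n)
_⇑ = TermSubst._↑ tySubst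

ren-sub : ∀ {m n o} A {ρ : Sub Fin m n} {σ : Sub Ty n o} {τ : Sub Ty m o} →
          (∀ x → lookup σ (lookup ρ x) ≡ lookup τ x) → A /Var ρ / σ ≡ A / τ

ren-sub-↑ : ∀ {m n o} (A : Ty (suc m)) {ρ : Sub Fin m n} {σ : Sub Ty n o}
            {τ : Sub Ty m o} → (∀ x → lookup σ (lookup ρ x) ≡ lookup τ x) →
            A /Var ρ VarSubst.↑ / σ ⇑ ≡ A / τ ⇑
ren-sub-↑ A {ρ} {σ} {τ} h = ren-sub A λ where
  zero    → refl
  (suc x) → trans (cong (lookup (σ ⇑)) (lookup-map x suc ρ))
           (trans (lookup-map (lookup ρ x) weaken σ)
           (trans (cong weaken (h x)) (sym (lookup-map x weaken τ))))

ren-sub (var x) h = h x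
ren-sub (A ⇒ B) h = cong₂ _⇒_ (ren-sub A h) (ren-sub B h)
ren-sub (∀′ A)  h = cong ∀′ (ren-sub-↑ A h)
ren-sub 𝟘       h = refl
ren-sub 𝟙       h = refl
ren-sub (A ⊕ B) h = cong₂ _⊕_ (ren-sub A h) (ren-sub B h)
ren-sub (A ⊗ B) h = cong₂ _⊗_ (ren-sub A h) (ren-sub B h)
ren-sub (μ A)   h = cong μ (ren-sub-↑ A h)
ren-sub (ν A)   h = cong ν (ren-sub-↑ A h)

-- Occurrences and well-formedness under substitution

Absent : ∀ {n} → Fin n → Ty n → Set
Absent x A = ∀ s → occ s x A ≡ 0

opposite-involutive : ∀ s → opposite (opposite s) ≡ s
opposite-involutive Sign.+ = refl
opposite-involutive Sign.- = refl

absent-⇒ˡ : ∀ {n} {x : Fin n} A B → Absent x (A ⇒ B) → Absent x A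
absent-⇒ˡ {x = x} A B h s = subst (λ t → occ t x A ≡ 0) (opposite-involutive s)
  (ℕ.m+n≡0⇒m≡0 _ (h (opposite s)))

absent-⇒ʳ : ∀ {n} {x : Fin n} A B → Absent x (A ⇒ B) → Absent x B
absent-⇒ʳ {x = x} A B h s = ℕ.m+n≡0⇒n≡0 (occ (opposite s) x A) (h s)

occ-var-self : ∀ {n} (x : Fin n) → occ Sign.+ x (var x) ≡ 1
occ-var-self zero    = refl
occ-var-self (suc x) = occ-var-self x

-- The disjunction covers both the identity substitution and a substitution for a variable that does
-- not occur in `A`.
sub-id : ∀ {n} A {σ : Sub Ty n n} →
         (∀ x → Absent x A ⊎ lookup σ x ≡ var x) → A / σ ≡ A

sub-id-↑ : ∀ {n} (A : Ty (suc n)) {σ : Sub Ty n n} →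
           (∀ x → Absent (suc x) A ⊎ lookup σ x ≡ var x) → A / σ ⇑ ≡ A
sub-id-↑ A {σ} h = sub-id A λ where
  zero    → inj₂ refl
  (suc x) → Sum.map₂ (λ e → trans (lookup-map x weaken σ)
    (trans (cong weaken e) (cong var (VarLemmas.lookup-wk x)))) (h x)

sub-id (var x) h with h x
... | inj₁ a = contradiction (trans (sym (occ-var-self x)) (a Sign.+)) λ ()
... | inj₂ e = e
sub-id (A ⇒ B) h = cong₂ _⇒_ (sub-id A λ x → Sum.map₁ (absent-⇒ˡ A B) (h x))
                             (sub-id B λ x → Sum.map₁ (absent-⇒ʳ A B) (h x))
sub-id (∀′ A)  h = cong ∀′ (sub-id-↑ A h)
sub-id 𝟘       h = refl
sub-id 𝟙       h = refl
sub-id (A ⊕ B) h = cong₂ _⊕_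
  (sub-id A λ x → Sum.map₁ (λ a s → ℕ.m+n≡0⇒m≡0 _ (a s)) (h x))
  (sub-id B λ x → Sum.map₁ (λ a s → ℕ.m+n≡0⇒n≡0 (occ s x A) (a s)) (h x))
sub-id (A ⊗ B) h = cong₂ _⊗_
  (sub-id A λ x → Sum.map₁ (λ a s → ℕ.m+n≡0⇒m≡0 _ (a s)) (h x))
  (sub-id B λ x → Sum.map₁ (λ a s → ℕ.m+n≡0⇒n≡0 (occ s x A) (a s)) (h x))
sub-id (μ A)   h = cong μ (sub-id-↑ A h)
sub-id (ν A)   h = cong ν (sub-id-↑ A h)

opposite-* : ∀ t s → opposite t Sign.* s ≡ t Sign.* opposite s
opposite-* Sign.+ s = refl
opposite-* Sign.- Sign.+ = refl
opposite-* Sign.- Sign.- = refl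

occ-var-zero : ∀ {n} s {x : Fin n} → occ s (suc x) (var zero) ≡ 0
occ-var-zero Sign.+ = refl
occ-var-zero Sign.- = refl

-- Signs multiply along the path: an occurrence of sign `s` in `A / σ` lies in the image of some
-- occurrence of a variable `y` in `A`, of sign `t` say, and within `lookup σ y` it has sign
-- `t * s`.
occ-sub : ∀ {m n} s {x : Fin n} (A : Ty m) {σ : Sub Ty m n} →
          (∀ t y → occ t y A ≡ 0 ⊎ occ (t Sign.* s) x (lookup σ y) ≡ 0) →
          occ s x (A / σ) ≡ 0

occ-sub-↑ : ∀ {m n} s {x : Fin n} (A : Ty (suc m)) {σ : Sub Ty m n} →
            (∀ t y → occ t (suc y) A ≡ 0 ⊎ occ (t Sign.* s) x (lookup σ y) ≡ 0) →
            occ s (suc x) (A / σ ⇑) ≡ 0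
occ-sub-↑ s {x} A {σ} h = occ-sub s A λ where
  t zero    → inj₂ (occ-var-zero (t Sign.* s) {x})
  t (suc y) → Sum.map₂ (λ e → trans (cong (occ (t Sign.* s) (suc x)) (lookup-map y weaken σ))
                              (trans (occ-weaken (t Sign.* s) x (lookup σ y)) e)) (h t y)

occ-sub s (var y) h with h Sign.+ y
... | inj₁ e = contradiction (trans (sym (occ-var-self y)) e) λ ()
... | inj₂ e = e
occ-sub s {x} (A ⇒ B) {σ} h = cong₂ _+_
  (occ-sub (opposite s) A λ t y → Sum.map
    (λ e → subst (λ t → occ t y A ≡ 0) (opposite-involutive t) (ℕ.m+n≡0⇒m≡0 _ e))
    (subst (λ t → occ t x (lookup σ y) ≡ 0) (opposite-* t s)) (h (opposite t) y))
  (occ-sub s B λ t y → Sum.map₁ (ℕ.m+n≡0⇒n≡0 (occ (opposite t) y A)) (h t y))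
occ-sub s (∀′ A)  h = occ-sub-↑ s A h
occ-sub s 𝟘       h = refl
occ-sub s 𝟙       h = refl
occ-sub s (A ⊕ B) h = cong₂ _+_
  (occ-sub s A λ t y → Sum.map₁ (ℕ.m+n≡0⇒m≡0 _) (h t y))
  (occ-sub s B λ t y → Sum.map₁ (ℕ.m+n≡0⇒n≡0 (occ t y A)) (h t y))
occ-sub s (A ⊗ B) h = cong₂ _+_
  (occ-sub s A λ t y → Sum.map₁ (ℕ.m+n≡0⇒m≡0 _) (h t y))
  (occ-sub s B λ t y → Sum.map₁ (ℕ.m+n≡0⇒n≡0 (occ t y A)) (h t y))
occ-sub s (μ A)   h = occ-sub-↑ s A h
occ-sub s (ν A)   h = occ-sub-↑ s A h

WF-ren : ∀ {m n} {A : Ty m} {ρ : Sub Fin m n} → WF A → WF (A /Var ρ)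

positive-ren-↑ : ∀ {m n} (A : Ty (suc m)) {ρ : Sub Fin m n} →
                 OnlyPositive zero A → OnlyPositive zero (A /Var ρ VarSubst.↑)
positive-ren-↑ A {ρ} p = trans (occ-ren Sign.- A λ where
  zero    → refl
  (suc z) → cong (λ i → does (zero ≟ i)) (lookup-map z suc ρ)) p

WF-ren (var x) = var _
WF-ren (a ⇒ b) = WF-ren a ⇒ WF-ren b
WF-ren (∀′ a)  = ∀′ (WF-ren a)
WF-ren 𝟘       = 𝟘
WF-ren 𝟙       = 𝟙
WF-ren (a ⊕ b) = WF-ren a ⊕ WF-ren b
WF-ren (a ⊗ b) = WF-ren a ⊗ WF-ren b
WF-ren (μ {A} p a) = μ (positive-ren-↑ A p) (WF-ren a)
WF-ren (ν {A} p a) = ν (positive-ren-↑ A p) (WF-ren a)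

WF-sub : ∀ {m n} {A : Ty m} {σ : Sub Ty m n} → (∀ x → WF (lookup σ x)) →
         WF A → WF (A / σ)

WF-⇑ : ∀ {m n} {σ : Sub Ty m n} → (∀ x → WF (lookup σ x)) → ∀ x → WF (lookup (σ ⇑) x)
WF-⇑         h zero    = var zero
WF-⇑ {σ = σ} h (suc x) = subst WF (sym (lookup-map x weaken σ)) (WF-ren (h x))

positive-sub-↑ : ∀ {m n} (A : Ty (suc m)) {σ : Sub Ty m n} →
                 OnlyPositive zero A → OnlyPositive zero (A / σ ⇑)
positive-sub-↑ A {σ} p = occ-sub Sign.- A λ where
  Sign.+ zero    → inj₂ refl
  Sign.- zero    → inj₁ p
  t      (suc y) → inj₂ (trans (cong (occ (t Sign.* Sign.-) zero) (lookup-map y weaken σ))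
                               (occ-weaken-zero (t Sign.* Sign.-) (lookup σ y)))

WF-sub h (var x) = h x
WF-sub h (a ⇒ b) = WF-sub h a ⇒ WF-sub h b
WF-sub h (∀′ a)  = ∀′ (WF-sub (WF-⇑ h) a)
WF-sub h 𝟘       = 𝟘
WF-sub h 𝟙       = 𝟙
WF-sub h (a ⊕ b) = WF-sub h a ⊕ WF-sub h b
WF-sub h (a ⊗ b) = WF-sub h a ⊗ WF-sub h b
WF-sub h (μ {A} p a) = μ (positive-sub-↑ A p) (WF-sub (WF-⇑ h) a)
WF-sub h (ν {A} p a) = ν (positive-sub-↑ A p) (WF-sub (WF-⇑ h) a)

lookup-id : ∀ {n} (x : Fin n) → lookup (TermSubst.id tySubst) x ≡ var x
lookup-id zero    = refl
lookup-id (suc x) = trans (lookup-map x weaken (TermSubst.id tySubst))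
  (trans (cong weaken (lookup-id x)) (cong var (VarLemmas.lookup-wk x)))

weaken-sub : ∀ {n} (A : Ty n) {B} → weaken A / sub B ≡ A
weaken-sub A {B} = trans
  (ren-sub A {τ = TermSubst.id tySubst} λ x → cong (lookup (sub B)) (VarLemmas.lookup-wk x))
  (sub-id A λ x → inj₂ (lookup-id x))

WF-sub₁ : ∀ {n} {A : Ty (suc n)} {B} → WF A → WF B → WF (A / sub B)
WF-sub₁ a b = WF-sub (λ where
  zero    → b
  (suc x) → subst WF (sym (lookup-id x)) (var x)) a

⇛-ren : ∀ {m n} As {B : Ty m} {ρ : Sub Fin m n} →
        (As ⇛ B) /Var ρ ≡ map (_/Var ρ) As ⇛ (B /Var ρ)
⇛-ren []       = refl
⇛-ren (A ∷ As) = cong ((A /Var _) ⇒_) (⇛-ren As)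

⇛-sub : ∀ {m n} As {B : Ty m} {σ : Sub Ty m n} →
        (As ⇛ B) / σ ≡ map (_/ σ) As ⇛ (B / σ)
⇛-sub []       = refl
⇛-sub (A ∷ As) = cong ((A / _) ⇒_) (⇛-sub As)

∏-ren : ∀ {m n} (As : List (Ty m)) {ρ : Sub Fin m n} → ∏ As /Var ρ ≡ ∏ (map (_/Var ρ) As)
∏-ren []           = refl
∏-ren (A ∷ [])     = refl
∏-ren (A ∷ B ∷ As) = cong ((A /Var _) ⊗_) (∏-ren (B ∷ As))

occ-∏ : ∀ {n} s {x : Fin n} {As} → All (λ A → occ s x A ≡ 0) As → occ s x (∏ As) ≡ 0
occ-∏ s []           = refl
occ-∏ s (p ∷ [])     = p
occ-∏ s (p ∷ q ∷ ps) = cong₂ _+_ p (occ-∏ s (q ∷ ps))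

WF-∏ : ∀ {n} {As : List (Ty n)} → All WF As → WF (∏ As)
WF-∏ []           = 𝟙
WF-∏ (a ∷ [])     = a
WF-∏ (a ∷ b ∷ as) = a ⊗ WF-∏ (b ∷ as)

WF-⇛ : ∀ {n} {As} {B : Ty n} → All WF As → WF B → WF (As ⇛ B)
WF-⇛ []       b = b
WF-⇛ (a ∷ as) b = a ⇒ WF-⇛ as b

-- The equational theory

WF-closure : ∀ {n} {A : Ty n} → WF A → WF (∀-closure A)
WF-closure {zero}  a = a
WF-closure {suc n} a = WF-closure (∀′ a)

closure-cong : ∀ {n} {A B : Ty n} → A ≡Y B → ∀-closure A ≡Y ∀-closure B
closure-cong {zero}  e = e
closure-cong {suc n} e = closure-cong (∀-cong e)

closure-weaken : ∀ {n} {A : Ty n} → WF A → ∀-closure (weaken A) ≡Y ∀-closure A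
closure-weaken {A = A} a = closure-cong (≡Y-sym (axiom a (∀′ (WF-ren a)) (∀-void A)))

closure-⊗ : ∀ {n} {A B : Ty n} → WF A → WF B →
            ∀-closure (A ⊗ B) ≡Y ∀-closure A ⊗ ∀-closure B
closure-⊗ {zero}  a b = ≡Y-refl (a ⊗ b)
closure-⊗ {suc n} {A} {B} a b = ≡Y-trans
  (closure-cong (axiom (∀′ (a ⊗ b)) (∀′ a ⊗ ∀′ b) (∀-⊗ A B))) (closure-⊗ (∀′ a) (∀′ b))

closure-𝟙 : ∀ n → ∀-closure {n} 𝟙 ≡Y 𝟙
closure-𝟙 zero    = ≡Y-refl 𝟙
closure-𝟙 (suc n) = ≡Y-trans (closure-weaken {n} {𝟙} 𝟙) (closure-𝟙 n)

WF-if : ∀ {n} b {A B : Ty n} → WF A → WF B → WF (if b then A else B)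
WF-if false a b = b
WF-if true  a b = a

WF-μ? : ∀ {n} {A : Ty (suc n)} → OnlyPositive zero A → WF A → WF (μ? A)
WF-μ? {A = A} p a = WF-if (does (occurs? zero A)) (μ p a) (WF-sub₁ a 𝟘)

WF-ν? : ∀ {n} {A : Ty (suc n)} → OnlyPositive zero A → WF A → WF (ν? A)
WF-ν? {A = A} p a = WF-if (does (occurs? zero A)) (ν p a) (WF-sub₁ a 𝟘)

¬occurs : ∀ {n} {x : Fin n} (A : Ty n) → Absent x A → does (occurs? x A) ≡ false
¬occurs A h rewrite h Sign.+ | h Sign.- = refl

μ?-absent : ∀ {n} (A : Ty (suc n)) → Absent zero A → μ? A ≡ A / sub 𝟘
μ?-absent A h = cong (if_then μ A else A / sub 𝟘) (¬occurs A h)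

ν?-absent : ∀ {n} (A : Ty (suc n)) → Absent zero A → ν? A ≡ A / sub 𝟘
ν?-absent A h = cong (if_then ν A else A / sub 𝟘) (¬occurs A h)

μ?-weaken : ∀ {n} (A : Ty n) → μ? (weaken A) ≡ A
μ?-weaken A = trans (μ?-absent (weaken A) λ s → occ-weaken-zero s A) (weaken-sub A)

ν?-weaken : ∀ {n} (A : Ty n) → ν? (weaken A) ≡ A
ν?-weaken A = trans (ν?-absent (weaken A) λ s → occ-weaken-zero s A) (weaken-sub A)

pull-0 : ∀ {n} (A : Ty (suc n)) → A /Var pull 0 ≡ A
pull-0 A = ren-id A λ where
  zero    → refl
  (suc x) → VarLemmas.lookup-wk x

-- This is (Y+) with no Y's, a single premise and no Z's, where the sum of products collapses to one
-- product; `pull 0` is the identity renaming.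
yoneda⁺ : ∀ {n} As (B : Ty (suc n)) → All WF As → WF B →
          All (OnlyPositive zero) As → OnlyPositive zero B →
          ∀′ ((As ⇛ var zero) ⇒ B) ≡Y B / sub (μ? (∏ As))
yoneda⁺ As B as b p q = subst (_≡Y B / sub (μ? (∏ As))) (cong ∀′ (pull-0 ((As ⇛ var zero) ⇒ B)))
  (axiom (∀′ (WF-ren (WF-⇛ as (var zero) ⇒ b)))
         (WF-sub₁ b (WF-μ? (occ-∏ Sign.- p) (WF-∏ as)))
         (Y+ 0 ((0 , As) ∷ []) B (p ∷ []) q))

yoneda⁻ : ∀ {n} A (B : Ty (suc n)) → WF A → WF B →
          OnlyPositive zero A → OnlyNegative zero B →
          ∀′ ((var zero ⇒ A) ⇒ B) ≡Y B / sub (ν? A)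
yoneda⁻ A B a b p q = subst (_≡Y B / sub (ν? A)) (cong ∀′ (pull-0 ((var zero ⇒ A) ⇒ B)))
  (axiom (∀′ (WF-ren ((var zero ⇒ a) ⇒ b)))
         (WF-sub₁ b (WF-ν? p a))
         (Y− 0 ((0 , A) ∷ []) B (p ∷ []) q))

-- Read from right to left, this introduces variable 0 as a name for `A` at positive places. The
-- name does not occur in the weakened `A`, so no μ is written.
name⁺ : ∀ {n} A (B : Ty (suc n)) → WF A → WF B → OnlyPositive zero B →
        ∀′ ((weaken A ⇒ var zero) ⇒ B) ≡Y B / sub A
name⁺ A B a b q = subst (λ C → ∀′ ((weaken A ⇒ var zero) ⇒ B) ≡Y B / sub C) (μ?-weaken A)
  (yoneda⁺ (weaken A ∷ []) B (WF-ren a ∷ []) b (occ-weaken-zero Sign.- A ∷ []) q)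

name⁻ : ∀ {n} A (B : Ty (suc n)) → WF A → WF B → OnlyNegative zero B →
        ∀′ ((var zero ⇒ weaken A) ⇒ B) ≡Y B / sub A
name⁻ A B a b q = subst (λ C → ∀′ ((var zero ⇒ weaken A) ⇒ B) ≡Y B / sub C) (ν?-weaken A)
  (yoneda⁻ (weaken A) B (WF-ren a) b (occ-weaken-zero Sign.- A) q)

-- ∀′ (A /Var bind x) is ∀x.A, still over the same n variables, x being unused.
bind : ∀ {n} → Fin n → Sub Fin n (suc n)
bind x = tabulate λ y → if does (x ≟ y) then zero else suc y

infix 9 _≔_

_≔_ : ∀ {n} → Fin n → Ty n → Sub Ty n n
x ≔ A = tabulate λ y → if does (x ≟ y) then A else var y

lookup-ext : ∀ {A : Set} {n} {ρ σ : Vec A n} → (∀ x → lookup ρ x ≡ lookup σ x) → ρ ≡ σ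
lookup-ext {ρ = ρ} {σ} h = trans (sym (tabulate∘lookup ρ))
    (trans (tabulate-cong h) (tabulate∘lookup σ))

-- `∀-void` settles variable 0, and `∀-swap` carries the quantifier of any other variable inwards
-- step by step. A vacuous quantifier stays at the old place, so the other variables keep their
-- numbers.
closure-bind : ∀ {n} x (A : Ty n) → WF A → ∀-closure A ≡Y ∀-closure (∀′ (A /Var bind x))
closure-bind {suc n} zero A a =
  subst (λ ρ → ∀-closure A ≡Y ∀-closure (∀′ (A /Var ρ))) (lookup-ext eq)
    (≡Y-sym (closure-weaken (∀′ a)))
  where
  eq : ∀ x → lookup (VarSubst.wk VarSubst.↑) x ≡ lookup (bind zero) x
  eq zero    = refl
  eq (suc x) = trans (lookup-map x suc VarSubst.wk)
    (trans (cong suc (VarLemmas.lookup-wk x)) (sym (lookup∘tabulate _ x)))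
closure-bind {suc n} (suc x) A a = ≡Y-trans (closure-bind x (∀′ A) (∀′ a))
  (subst (λ B → ∀-closure (∀′ (∀′ (A /Var bind x VarSubst.↑))) ≡Y ∀-closure (∀′ (∀′ B)))
    (ren-ren A eq)
    (closure-cong (axiom (∀′ (∀′ (WF-ren a))) (∀′ (∀′ (WF-ren (WF-ren a))))
      (∀-swap (A /Var bind x VarSubst.↑)))))
  where
  swap-if : ∀ b (y : Fin n) → lookup (pull 1) (suc (if b then zero else suc y)) ≡
      (if b then zero else suc (suc y))
  swap-if true  y = refl
  swap-if false y = trans (lookup-map y suc (Vec.map suc VarSubst.id))
      (cong suc (VarLemmas.lookup-wk y))
  eq : ∀ y → lookup (pull 1) (lookup (bind x VarSubst.↑) y) ≡ lookup (bind (suc x)) y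
  eq zero    = refl
  eq (suc y) = trans (cong (lookup (pull 1))
      (trans (lookup-map y suc (bind x)) (cong suc (lookup∘tabulate _ y))))
    (trans (swap-if (does (x ≟ y)) y) (sym (lookup∘tabulate _ y)))

occ-bind : ∀ {n} s (x : Fin n) A → occ s zero (A /Var bind x) ≡ occ s x A
occ-bind {n} s x A = occ-ren s A λ z →
  trans (cong (λ i → does (zero ≟ i)) (lookup∘tabulate _ z)) (lem (does (x ≟ z)) z)
  where
  lem : ∀ b (z : Fin n) → does (zero ≟ (if b then zero else suc z)) ≡ b
  lem true  z = refl
  lem false z = refl

bind-sub : ∀ {n} (x : Fin n) A B → A /Var bind x / sub B ≡ A / x ≔ B
bind-sub {n} x A B = ren-sub A λ z →
  trans (cong (lookup (sub B)) (lookup∘tabulate _ z))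
    (trans (lem (does (x ≟ z)) z) (sym (lookup∘tabulate _ z)))
  where
  lem : ∀ b (z : Fin n) → lookup (sub B) (if b then zero else suc z) ≡ (if b then B else var z)
  lem true  z = refl
  lem false z = lookup-id z

≔-absent : ∀ {n} {x : Fin n} A {B} → Absent x A → A / x ≔ B ≡ A
≔-absent {x = x} A {B} h = sub-id A lem
  where
  lem : ∀ y → Absent y A ⊎ lookup (x ≔ B) y ≡ var y
  lem y with x ≟ y in eq
  ... | yes refl = inj₁ h
  ... | no  _    = inj₂ (trans (lookup∘tabulate _ y) (cong (if_then B else var y) (cong does eq)))

-- The least solution {μx.} of ⟨As⟩ ⇒ x.
least : ∀ {n} → Fin n → List (Ty n) → Ty n
least x As = μ? (∏ (map (_/Var bind x) As))

-- `closure-bind` makes the quantifier of `x` the innermost one, where `yoneda⁺` applies.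
eliminate : ∀ {n} x As (B : Ty n) → All WF As → WF B →
            All (OnlyPositive x) As → OnlyPositive x B →
            ∀-closure ((As ⇛ var x) ⇒ B) ≡Y ∀-closure (B / x ≔ least x As)
eliminate x As B as b p q = ≡Y-trans (closure-bind x ((As ⇛ var x) ⇒ B) (WF-⇛ as (var x) ⇒ b))
  (subst₂ (λ C D → ∀-closure (∀′ (C ⇒ (B /Var bind x))) ≡Y ∀-closure D)
    (sym (trans (⇛-ren As) (cong (map (_/Var bind x) As ⇛_) (cong var bind-self))))
    (bind-sub x B (least x As))
    (closure-cong (yoneda⁺ (map (_/Var bind x) As) (B /Var bind x)
      (All.map⁺ (All.map WF-ren as)) (WF-ren b)
      (All.map⁺ (All.map (λ {A} → trans (occ-bind Sign.- x A)) p))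
      (trans (occ-bind Sign.- x B) q))))
  where
  bind-self : lookup (bind x) x ≡ zero
  bind-self with x ≟ x in eq
  ... | yes _ = trans (lookup∘tabulate _ x) (cong (if_then zero else suc x) (cong does eq))
  ... | no ne = contradiction refl ne

least-absent : ∀ {n} (x : Fin n) As → All (Absent x) As → least x As ≡ ∏ As
least-absent x As h rewrite sym (∏-ren As {bind x}) = trans
  (μ?-absent (∏ As /Var bind x) λ s → trans (occ-bind s x (∏ As)) (absent s))
  (trans (bind-sub x (∏ As) 𝟘) (≔-absent (∏ As) absent))
  where
  absent : Absent x (∏ As)
  absent s = occ-∏ s (All.map (λ h → h s) h)

WF-least : ∀ {n} (x : Fin n) {As} → All WF As → All (OnlyPositive x) As → WF (least x As)
WF-least x as p = WF-μ? (occ-∏ Sign.- (All.map⁺ (All.map (λ {A} → trans (occ-bind Sign.- x A)) p)))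
  (WF-∏ (All.map⁺ (All.map WF-ren as)))

WF-≔ : ∀ {n} {x : Fin n} {A B} → WF A → WF B → WF (A / x ≔ B)
WF-≔ {x = x} {B = B} a b = WF-sub (λ y → subst WF (sym (lookup∘tabulate _ y))
    (WF-if (does (x ≟ y)) b (var y))) a

-- Clauses

-- ((cs₁ , a₁) ∷ … ∷ (csₖ , aₖ) ∷ [] , x) stands for the type
-- (cs₁ ⇛ a₁) ⇒ … ⇒ (csₖ ⇛ aₖ) ⇒ x.
Subgoal Clause : ℕ → Set
Subgoal n = List (Fin n) × Fin n
Clause  n = List (Subgoal n) × Fin n

body : ∀ {n} → Clause n → List (Subgoal n)
body = proj₁

head : ∀ {n} → Clause n → Fin n
head = proj₂

facts : ∀ {n} → List (Fin n) → List (Clause n)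
facts = map ([] ,_)

-- The index bounds the height of the derivation.
Derivable : ∀ {n} → ℕ → List (Clause n) → Fin n → Set
Derivable zero    Δ x = ⊥
Derivable (suc h) Δ x = ∃[ κ ] κ ∈ Δ × head κ ≡ x ×
  All (λ (cs , a) → Derivable h (facts cs ++ Δ) a) (body κ)

Derivables : ∀ {n} → ℕ → List (Clause n) → List (Subgoal n) → Set
Derivables h Δ = All (λ (cs , a) → Derivable h (facts cs ++ Δ) a)

goals   : ∀ {n} h {Δ : List (Clause n)} {x} → Derivable h Δ x → List (Fin n)
goals-s : ∀ {n} h {Δ : List (Clause n)} {b} → Derivables h Δ b → List (Fin n)
goals (suc h) (κ , _ , _ , ds) = head κ ∷ goals-s h ds
goals-s h []       = []
goals-s h (d ∷ ds) = goals h d ++ goals-s h ds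

goal∈goals : ∀ {n} h {Δ : List (Clause n)} {x} (d : Derivable h Δ x) → x ∈ goals h d
goal∈goals (suc h) (κ , _ , eq , _) = here (sym eq)

goals⊆goals-s : ∀ {n} h {Δ : List (Clause n)} {b s} (ds : Derivables h Δ b) (s∈b : s ∈ b) →
                ∀ {y} → y ∈ goals h (All.lookup ds s∈b) → y ∈ goals-s h ds
goals⊆goals-s h (d ∷ ds) (here refl) y∈ = ∈-++⁺ˡ y∈
goals⊆goals-s h (d ∷ ds) (there s∈b) y∈ = ∈-++⁺ʳ (goals h d) (goals⊆goals-s h ds s∈b y∈)

∈-goals-s⁻ : ∀ {n} h {Δ : List (Clause n)} {b} (ds : Derivables h Δ b) {y} → y ∈ goals-s h ds →
             ∃[ s ] ∃ λ (s∈b : s ∈ b) → y ∈ goals h (All.lookup ds s∈b)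
∈-goals-s⁻ h (d ∷ ds) y∈ with ∈-++⁻ (goals h d) y∈
... | inj₁ y∈d  = _ , here refl , y∈d
... | inj₂ y∈ds = let s , s∈b , y∈ = ∈-goals-s⁻ h ds y∈ds in s , there s∈b , y∈

++-monoʳ : ∀ {n} (Γ : List (Clause n)) {Δ Δ′} {P : Clause n → Set} →
           (∀ {κ} → κ ∈ Δ → P κ → κ ∈ Δ′) → ∀ {κ} → κ ∈ Γ ++ Δ → P κ → κ ∈ Γ ++ Δ′
++-monoʳ Γ h κ∈ p with ∈-++⁻ Γ κ∈
... | inj₁ κ∈Γ = ∈-++⁺ˡ κ∈Γ
... | inj₂ κ∈Δ = ∈-++⁺ʳ Γ (h κ∈Δ p)

-- A derivation applies only clauses whose heads are goals that it visits, so all other clauses of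
-- the context may be dropped.
transport : ∀ {n} h {Δ Δ′ : List (Clause n)} {x} (d : Derivable h Δ x) →
            (∀ {κ} → κ ∈ Δ → head κ ∈ goals h d → κ ∈ Δ′) → Derivable h Δ′ x
transport-s : ∀ {n} h {Δ Δ′ : List (Clause n)} {b} (ds : Derivables h Δ b) →
              (∀ {κ} → κ ∈ Δ → head κ ∈ goals-s h ds → κ ∈ Δ′) → Derivables h Δ′ b
transport (suc h) (κ , κ∈ , eq , ds) p =
  κ , p κ∈ (here refl) , eq , transport-s h ds (λ κ∈ → p κ∈ ∘ there)
transport-s h [] p = []
transport-s h {b = (cs , _) ∷ _} (d ∷ ds) p =
  transport h d (++-monoʳ (facts cs) λ κ∈ → p κ∈ ∘ ∈-++⁺ˡ) ∷
  transport-s h ds (λ κ∈ → p κ∈ ∘ ∈-++⁺ʳ (goals h d))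

derivable-⊆ : ∀ {n} h {Δ Δ′ : List (Clause n)} {x} → (∀ {κ} → κ ∈ Δ → κ ∈ Δ′) →
              Derivable h Δ x → Derivable h Δ′ x
derivable-⊆ h p d = transport h d λ κ∈ _ → p κ∈

derivable-suc : ∀ {n} h {Δ : List (Clause n)} {x} → Derivable h Δ x → Derivable (suc h) Δ x
derivable-suc (suc h) (κ , κ∈ , eq , ds) = κ , κ∈ , eq , All.map (derivable-suc h) ds

-- Determinism of proof search

module Deterministic {n} (Δ : List (Clause n))
  (unique  : ∀ {κ κ′} → κ ∈ Δ → κ′ ∈ Δ → head κ ≡ head κ′ → κ ≡ κ′)
  (unbound : ∀ {κ κ′ cs a c} → κ ∈ Δ → κ′ ∈ Δ → (cs , a) ∈ body κ′ → c ∈ cs → head κ ≢ c) where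

  infix 4 _◁_

  _◁_ : Fin n → Fin n → Set
  a ◁ x = ∃[ κ ] κ ∈ Δ × head κ ≡ x × ∃[ cs ] (cs , a) ∈ body κ

  -- Derivations only enlarge Δ by facts about bound variables, and these head no
  -- clause of Δ; hence the clause used for a goal does not depend on the context.
  Extends : List (Clause n) → Set
  Extends Δ′ = ∀ {κ} → κ ∈ Δ′ → κ ∈ Δ ⊎ (body κ ≡ [] × (∀ {κ′} → κ′ ∈ Δ → head κ′ ≢ head κ))

  extends-facts : ∀ {Δ′ κ cs a} → Extends Δ′ → κ ∈ Δ′ → (cs , a) ∈ body κ → Extends (facts cs ++ Δ′)
  extends-facts {cs = cs} ext κ∈ s∈ κ′∈ with ∈-++⁻ (facts cs) κ′∈
  ... | inj₂ κ′∈Δ′ = ext κ′∈Δ′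
  ... | inj₁ κ′∈cs with ∈-map⁻ ([] ,_) κ′∈cs | ext κ∈
  ...   | c , c∈ , refl | inj₁ κ∈Δ = inj₂ (refl , λ κ″∈ → unbound κ″∈ κ∈Δ s∈ c∈)
  ...   | c , c∈ , refl | inj₂ (refl , _) with () ← s∈

  clause-of : ∀ {Δ′ κ κ′} → Extends Δ′ → κ ∈ Δ′ → κ′ ∈ Δ → head κ′ ≡ head κ → κ′ ≡ κ
  clause-of ext κ∈ κ′∈ eq with ext κ∈
  ... | inj₁ κ∈Δ      = unique κ′∈ κ∈Δ eq
  ... | inj₂ (_ , ne) = contradiction eq (ne κ′∈)

  -- The clause that derives `x` is the only candidate for heading `x` in `Δ`, so every `a ◁ x` is
  -- derived by an immediate subderivation, and induction on the height applies.
  accessible-goal : ∀ h {Δ′ x} → Extends Δ′ → Derivable h Δ′ x → Acc _◁_ x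
  accessible-goal (suc h) {Δ′} ext (κ , κ∈ , refl , ds) = acc below
    where
    below : ∀ {a} → a ◁ head κ → Acc _◁_ a
    below (κ′ , κ′∈ , eq , cs , s∈) with refl ← clause-of ext κ∈ κ′∈ eq =
      accessible-goal h (extends-facts ext κ∈ s∈) (All.lookup ds s∈)

  -- Wherever the head of `κ` is a goal, `κ` is the clause applied there, so its subgoals are
  -- visited as well. Visited clauses therefore never call an unvisited head.
  goals-closed : ∀ h {Δ′ x} → Extends Δ′ → (d : Derivable h Δ′ x) → ∀ {κ cs a} →
                 κ ∈ Δ → head κ ∈ goals h d → (cs , a) ∈ body κ → a ∈ goals h d
  goals-s-closed : ∀ h {Δ′ b} → (∀ {cs a} → (cs , a) ∈ b → Extends (facts cs ++ Δ′)) →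
                   (ds : Derivables h Δ′ b) → ∀ {κ cs a} →
                   κ ∈ Δ → head κ ∈ goals-s h ds → (cs , a) ∈ body κ → a ∈ goals-s h ds
  goals-closed (suc h) ext (κ , κ∈ , refl , ds) κ′∈ (here eq) s∈
    with refl ← clause-of ext κ∈ κ′∈ eq =
    there (goals⊆goals-s h ds s∈ (goal∈goals h (All.lookup ds s∈)))
  goals-closed (suc h) ext (κ , κ∈ , refl , ds) κ′∈ (there y∈) s∈ =
    there (goals-s-closed h (extends-facts ext κ∈) ds κ′∈ y∈ s∈)
  goals-s-closed h exts (d ∷ ds) κ′∈ y∈ s∈ with ∈-++⁻ (goals h d) y∈
  ... | inj₁ y∈d  = ∈-++⁺ˡ (goals-closed h (exts (here refl)) d κ′∈ y∈d s∈)
  ... | inj₂ y∈ds = ∈-++⁺ʳ (goals h d) (goals-s-closed h (exts ∘ there) ds κ′∈ y∈ds s∈)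

  subgoal-below : ∀ {Δ′ κ cs a} → Extends Δ′ → κ ∈ Δ′ → (cs , a) ∈ body κ → a ◁ head κ
  subgoal-below ext κ∈ s∈ with ext κ∈
  ... | inj₁ κ∈Δ = _ , κ∈Δ , refl , _ , s∈
  ... | inj₂ (refl , _) with () ← s∈

  goals-below : ∀ h {Δ′ x y} → Extends Δ′ → (d : Derivable h Δ′ x) → y ∈ goals h d →
                y ≡ x ⊎ TransClosure _◁_ y x
  goals-s-below : ∀ h {Δ′ κ y} → Extends Δ′ → κ ∈ Δ′ → (ds : Derivables h Δ′ (body κ)) →
                  y ∈ goals-s h ds → TransClosure _◁_ y (head κ)
  goals-below (suc h) ext (κ , κ∈ , refl , ds) (here eq)  = inj₁ eq
  goals-below (suc h) ext (κ , κ∈ , refl , ds) (there y∈) = inj₂ (goals-s-below h ext κ∈ ds y∈)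
  goals-s-below h {κ = κ} ext κ∈ ds y∈ with ∈-goals-s⁻ h ds y∈
  ... | (cs , a) , s∈ , y∈d = extend (goals-below h (extends-facts ext κ∈ s∈)
      (All.lookup ds s∈) y∈d)
    where
    a◁κ = subgoal-below ext κ∈ s∈
    extend : ∀ {y} → y ≡ a ⊎ TransClosure _◁_ y a → TransClosure _◁_ y (head κ)
    extend (inj₁ refl) = [ a◁κ ]
    extend (inj₂ y◁a)  = y◁a ◅◅ [ a◁κ ]

  -- A second visit to the goal would put it on a cycle of `_◁_`, which its accessibility excludes.
  goal∉subgoals : ∀ h {κ} → κ ∈ Δ → (ds : Derivables h Δ (body κ)) → head κ ∉ goals-s h ds
  goal∉subgoals h κ∈ ds x∈ = acc⇒asym (accessible _
      (accessible-goal (suc h) inj₁ (_ , κ∈ , refl , ds))) loop loop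
    where loop = goals-s-below h inj₁ κ∈ ds x∈

-- Elimination of unvisited heads

occ-var-≢ : ∀ {n} s {x y : Fin n} → x ≢ y → occ s x (var y) ≡ 0
occ-var-≢ Sign.+ {x} {y} ne = cong (if_then 1 else 0) (dec-false (x ≟ y) ne)
occ-var-≢ Sign.- ne = refl

occs : ∀ {n} → Sign → Fin n → List (Ty n) → ℕ
occs s x As = sum (map (occ s x) As)

occ-⇛ : ∀ {n} s {x : Fin n} As {B} → occ s x (As ⇛ B) ≡ occs (opposite s) x As + occ s x B
occ-⇛ s []       = refl
occ-⇛ s {x} (A ∷ As) = trans (cong (occ (opposite s) x A +_) (occ-⇛ s As))
  (sym (ℕ.+-assoc (occ (opposite s) x A) _ _))

occs-zero : ∀ {n} s {x : Fin n} {As} → All (λ A → occ s x A ≡ 0) As → occs s x As ≡ 0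
occs-zero s []       = refl
occs-zero s (p ∷ ps) = cong₂ _+_ p (occs-zero s ps)

occs-zero⁻ : ∀ {n} s {x : Fin n} As → occs s x As ≡ 0 → All (λ A → occ s x A ≡ 0) As
occs-zero⁻ s []       p = []
occs-zero⁻ s {x} (A ∷ As) p = ℕ.m+n≡0⇒m≡0 _ p ∷ occs-zero⁻ s As (ℕ.m+n≡0⇒n≡0 (occ s x A) p)

positive-sub : ∀ {m n} {x : Fin n} (A : Ty m) {σ : Sub Ty m n} →
               (∀ y → OnlyPositive x (lookup σ y)) →
               (∀ y → OnlyPositive y A ⊎ OnlyNegative x (lookup σ y)) →
               OnlyPositive x (A / σ)
positive-sub A p q = occ-sub Sign.- A λ where
  Sign.+ y → inj₂ (p y)
  Sign.- y → q y

positive-if : ∀ {n} {x : Fin n} b {A B} → OnlyPositive x A → OnlyPositive x B →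
              OnlyPositive x (if b then A else B)
positive-if true  p q = p
positive-if false p q = q

-- Both alternatives of `μ?` have to be covered. As `y` differs from `x`, `bind x` sends it to
-- `suc y`, where it is positive by assumption; substituting `𝟘` adds no occurrence.
positive-least : ∀ {n} {x y : Fin n} As → x ≢ y → All (OnlyPositive y) As →
                 OnlyPositive y (least x As)
positive-least {n} {x} {y} As x≢y p = positive-if (does (occurs? zero A)) {μ A} {A / sub 𝟘} pA
  (positive-sub A (λ where
      zero    → refl
      (suc z) → trans (cong (occ Sign.- y) (lookup-id z)) refl)
    (λ where
      zero → inj₂ refl
      (suc z) → rest z))
  where
  A = ∏ (map (_/Var bind x) As)
  does-bind : ∀ z → does (suc y ≟ lookup (bind x) z) ≡ does (y ≟ z)
  does-bind z with x ≟ z in eq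
  ... | yes refl = trans (cong (λ i → does (suc y ≟ i))
      (trans (lookup∘tabulate _ z) (cong (λ d → if does d then zero else suc z) eq)))
                         (sym (dec-false (y ≟ x) (x≢y ∘ sym)))
  ... | no  _    = cong (λ i → does (suc y ≟ i))
      (trans (lookup∘tabulate _ z) (cong (λ d → if does d then zero else suc z) eq))
  pA : occ Sign.- (suc y) A ≡ 0
  pA = occ-∏ Sign.- (All.map⁺ (All.map (λ {B} → trans (occ-ren Sign.- B does-bind)) p))
  rest : ∀ z → OnlyPositive (suc z) A ⊎ OnlyNegative y (lookup (TermSubst.id tySubst) z)
  rest z with y ≟ z
  ... | yes refl = inj₁ pA
  ... | no  y≢z  = inj₂ (trans (cong (occ Sign.+ y) (lookup-id z)) (occ-var-≢ Sign.+ y≢z))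

lookup-≔-≡ : ∀ {n} (x : Fin n) {A} → lookup (x ≔ A) x ≡ A
lookup-≔-≡ x {A} = trans (lookup∘tabulate _ x) (cong (if_then A else var x) (dec-true (x ≟ x) refl))

lookup-≔-≢ : ∀ {n} {x y : Fin n} {A} → x ≢ y → lookup (x ≔ A) y ≡ var y
lookup-≔-≢ {x = x} {y} {A} ne = trans (lookup∘tabulate _ y)
    (cong (if_then A else var y) (dec-false (x ≟ y) ne))

positive-≔ : ∀ {n} {x y : Fin n} A {B} → OnlyPositive x A → OnlyPositive y A → OnlyPositive y B →
             OnlyPositive y (A / x ≔ B)
positive-≔ {x = x} {y} A {B} px py pB = positive-sub A p q
  where
  p : ∀ z → OnlyPositive y (lookup (x ≔ B) z)
  p z with x ≟ z
  ... | yes refl = trans (cong (occ Sign.- y) (lookup-≔-≡ x)) pB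
  ... | no  ne   = cong (occ Sign.- y) (lookup-≔-≢ {A = B} ne)
  q : ∀ z → OnlyPositive z A ⊎ OnlyNegative y (lookup (x ≔ B) z)
  q z with x ≟ z | y ≟ z
  ... | yes refl | _        = inj₁ px
  ... | no _     | yes refl = inj₁ py
  ... | no ne    | no y≢z   = inj₂ (trans (cong (occ Sign.+ y) (lookup-≔-≢ {A = B} ne))
      (occ-var-≢ Sign.+ y≢z))

implication : ∀ {n} → List (Ty n) × Fin n → Ty n
implication (As , x) = As ⇛ var x

substitute : ∀ {n} → Sub Ty n n → List (Ty n) × Fin n → List (Ty n) × Fin n
substitute σ (As , x) = map (_/ σ) As , x

-- All heads differ from `x`, so the substitution acts on the premises only and the list keeps its
-- shape for the next step.
implications-sub : ∀ {n} {x : Fin n} {A} Gs → All (x ≢_) (map proj₂ Gs) →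
  map (_/ x ≔ A) (map implication Gs) ≡ map implication (map (substitute (x ≔ A)) Gs)
implications-sub []              []        = refl
implications-sub {A = A} ((As , y) ∷ Gs) (ne ∷ nes) = cong₂ _∷_
  (trans (⇛-sub As) (cong (map (_/ _) As ⇛_) (lookup-≔-≢ {A = A} ne)))
  (implications-sub Gs nes)

-- Each step substitutes a type, possibly a μ-type, for one head in the remaining
-- premises; R is never touched, and the last head occurs nowhere else.
prune : ∀ {n} (xs : List (Fin n)) Gs R → map proj₂ Gs ≡ xs → Unique xs →
        All (All WF ∘ proj₁) Gs → WF R →
        All (λ x → All (All (OnlyPositive x) ∘ proj₁) Gs) xs → All (λ x → Absent x R) xs →
        ∀-closure (map implication Gs ⇛ R) ≡Y ∀-closure R
prune []       []              R eq u wf r pos abs = ≡Y-refl (WF-closure r)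
prune (x ∷ xs) ((As , .x) ∷ Gs) R refl (x∉ ∷ u) (as ∷ wf) r ((px ∷ pxs) ∷ pos) (a ∷ abs) =
  ≡Y-trans
    (eliminate x As (map implication Gs ⇛ R) as
      (WF-⇛ (All.map⁺ (All.map (λ w → WF-⇛ w (var _)) wf)) r) px
      -- `x` is positive in the premises of each implication and is not its head, hence only
      -- negative in the implication and only positive once that stands left of an arrow.
      (trans (occ-⇛ Sign.- (map implication Gs))
        (cong₂ _+_ (occs-zero Sign.+ (negative Gs x∉ pxs)) (a Sign.-))))
    (subst (λ B → ∀-closure B ≡Y ∀-closure R)
      (sym (trans (⇛-sub (map implication Gs))
        (cong₂ _⇛_ (implications-sub Gs x∉) (≔-absent R a))))
      (prune xs (map (substitute (x ≔ M)) Gs) R (sym (List.map-∘ Gs)) u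
        (All.map⁺ (All.map (All.map⁺ ∘ All.map (λ w → WF-≔ {x = x} w wM)) wf)) r
        -- The other heads stay positive, because they are positive both in the premises and in the
        -- solution substituted for `x`.
        (All.zipWith (λ { {y} (ne , py ∷ pys) → All.map⁺ (All.zipWith (λ (qx , qy) →
            All.map⁺ (All.zipWith (λ {A} (qx , qy) → positive-≔ A qx qy
                (positive-least As ne py)) (qx , qy)))
          (pxs , pys)) }) (x∉ , pos))
        abs))
  where
  M = least x As
  wM = WF-least x as px
  negative : ∀ Gs → All (x ≢_) (map proj₂ Gs) → All (All (OnlyPositive x) ∘ proj₁) Gs →
             All (OnlyNegative x) (map implication Gs)
  negative []              []         []       = []
  negative ((Bs , y) ∷ Gs) (ne ∷ nes) (p ∷ ps) =
    trans (occ-⇛ Sign.+ Bs) (cong₂ _+_ (occs-zero Sign.- p)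
        (occ-var-≢ Sign.+ ne)) ∷ negative Gs nes ps

-- Premises, products and resolution of the goal

⇛-↭ : ∀ {n} {As Bs} {C : Ty n} → As ↭ Bs → All WF As → WF C → As ⇛ C ≡Y Bs ⇛ C
⇛-↭ ↭.refl        as           c = ≡Y-refl (WF-⇛ as c)
⇛-↭ (prep A p)    (a ∷ as)     c = ⇒-cong (≡Y-refl a) (⇛-↭ p as c)
⇛-↭ (swap A B p)  (a ∷ b ∷ as) c = ≡Y-trans
  (axiom (a ⇒ b ⇒ WF-⇛ as c) (b ⇒ a ⇒ WF-⇛ as c) (⇒-swap _ _ _))
  (⇒-cong (≡Y-refl b) (⇒-cong (≡Y-refl a) (⇛-↭ p as c)))
⇛-↭ (↭.trans p q) as           c = ≡Y-trans (⇛-↭ p as c) (⇛-↭ q (↭.All-resp-↭ p as) c)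

-- With `𝟙` written as `𝟘 ⇒ 𝟘`, swapping the two premises brings `𝟘` to the front, and `𝟘-⇒`
-- finishes.
⇒-𝟙 : ∀ {n} {A : Ty n} → WF A → A ⇒ 𝟙 ≡Y 𝟙
⇒-𝟙 a = ≡Y-trans (⇒-cong (≡Y-refl a) (≡Y-sym (axiom (𝟘 ⇒ 𝟘) 𝟙 (𝟘-⇒ 𝟘))))
  (≡Y-trans (axiom (a ⇒ 𝟘 ⇒ 𝟘) (𝟘 ⇒ a ⇒ 𝟘) (⇒-swap _ _ _)) (axiom (𝟘 ⇒ a ⇒ 𝟘) 𝟙 (𝟘-⇒ _)))

⇛-𝟙 : ∀ {n} {As : List (Ty n)} → All WF As → As ⇛ 𝟙 ≡Y 𝟙
⇛-𝟙 []       = ≡Y-refl 𝟙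
⇛-𝟙 (a ∷ as) = ≡Y-trans (⇒-cong (≡Y-refl a) (⇛-𝟙 as)) (⇒-𝟙 a)

⇛-⊗ : ∀ {n} {As} {B C : Ty n} → All WF As → WF B → WF C →
      As ⇛ (B ⊗ C) ≡Y (As ⇛ B) ⊗ (As ⇛ C)
⇛-⊗ []       b c = ≡Y-refl (b ⊗ c)
⇛-⊗ (a ∷ as) b c = ≡Y-trans (⇒-cong (≡Y-refl a) (⇛-⊗ as b c))
  (axiom (a ⇒ WF-⇛ as b ⊗ WF-⇛ as c) ((a ⇒ WF-⇛ as b) ⊗ (a ⇒ WF-⇛ as c)) (⇒-⊗ _ _ _))

-- Premises and quantifiers both distribute over the product, so each factor receives its own copy
-- of them and can be treated on its own.
closure-⇛-∏ : ∀ {n} {As Bs : List (Ty n)} → All WF As → All WF Bs →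
              All (λ B → ∀-closure (As ⇛ B) ≡Y 𝟙) Bs → ∀-closure (As ⇛ ∏ Bs) ≡Y 𝟙
closure-⇛-∏ {n} as [] [] = ≡Y-trans (closure-cong (⇛-𝟙 as)) (closure-𝟙 n)
closure-⇛-∏ as (b ∷ []) (e ∷ []) = e
closure-⇛-∏ as (b ∷ c ∷ cs) (e ∷ f ∷ es) = ≡Y-trans
  (closure-cong (⇛-⊗ as b (WF-∏ (c ∷ cs))))
  (≡Y-trans (closure-⊗ (WF-⇛ as b) (WF-⇛ as (WF-∏ (c ∷ cs))))
  (≡Y-trans (⊗-cong e (closure-⇛-∏ as (c ∷ cs) (f ∷ es)))
    (axiom (𝟙 ⊗ 𝟙) 𝟙 (⊗-identityʳ 𝟙))))

-- Since `x` occurs in neither `As` nor `Bs`, its solution is the plain product of `Bs`, without μ,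
-- and the only place it is substituted into is the goal.
resolve : ∀ {n} {x : Fin n} {As Bs} → All WF As → All WF Bs →
          All (Absent x) As → All (Absent x) Bs →
          ∀-closure ((Bs ⇛ var x) ⇒ (As ⇛ var x)) ≡Y ∀-closure (As ⇛ ∏ Bs)
resolve {x = x} {As} {Bs} as bs p q = subst
    (λ B → ∀-closure ((Bs ⇛ var x) ⇒ (As ⇛ var x)) ≡Y ∀-closure B) eq
  (eliminate x Bs (As ⇛ var x) bs (WF-⇛ as (var x)) (All.map (λ h → h Sign.-) q)
    (trans (occ-⇛ Sign.- As) (cong (_+ 0) (occs-zero Sign.+ (All.map (λ h → h Sign.+) p)))))
  where
  eq : (As ⇛ var x) / x ≔ least x Bs ≡ As ⇛ ∏ Bs
  eq = trans (⇛-sub As) (cong₂ _⇛_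
    (List.map-id-local (All.map (λ {A} → ≔-absent A) p))
    (trans (lookup-≔-≡ x) (least-absent x Bs q)))

-- Theories with at most one negative occurrence of each variable

subgoalTy : ∀ {n} → Subgoal n → Ty n
subgoalTy (cs , a) = map var cs ⇛ var a

clauseTy : ∀ {n} → Clause n → Ty n
clauseTy (b , x) = map subgoalTy b ⇛ var x

theoryTy : ∀ {n} → List (Clause n) → Fin n → Ty n
theoryTy Δ x = map clauseTy Δ ⇛ var x

WF-vars : ∀ {n} (cs : List (Fin n)) → All WF (map var cs)
WF-vars cs = All.map⁺ (All.universal (λ _ → var _) cs)

WF-subgoals : ∀ {n} (b : List (Subgoal n)) → All WF (map subgoalTy b)
WF-subgoals b = All.map⁺ (All.universal (λ (cs , _) → WF-⇛ (WF-vars cs) (var _)) b)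

WF-clauses : ∀ {n} (Δ : List (Clause n)) → All WF (map clauseTy Δ)
WF-clauses Δ = All.map⁺ (All.universal (λ (b , _) → WF-⇛ (WF-subgoals b) (var _)) Δ)

-- The sign is positive because the clauses stand to the left of an arrow in `theoryTy`: these are
-- the negative occurrences contributed to the whole type.
negs : ∀ {n} → Fin n → List (Clause n) → ℕ
negs x Δ = occs Sign.+ x (map clauseTy Δ)

Linear : ∀ {n} → List (Clause n) → Set
Linear Δ = ∀ x → negs x Δ ≤ 1

negs-++ : ∀ {n} x (Γ : List (Clause n)) {Δ} → negs x (Γ ++ Δ) ≡ negs x Γ + negs x Δ
negs-++ x [] = refl
negs-++ x (κ ∷ Γ) = trans (cong (occ Sign.+ x (clauseTy κ) +_) (negs-++ x Γ))
    (sym (ℕ.+-assoc (occ Sign.+ x (clauseTy κ)) _ _))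

negs-↭ : ∀ {n} x {Γ Δ : List (Clause n)} → Γ ↭ Δ → negs x Γ ≡ negs x Δ
negs-↭ x p = sum-↭ (↭.map⁺ (occ Sign.+ x) (↭.map⁺ clauseTy p))

negs-∈ : ∀ {n} x {κ} {Δ : List (Clause n)} → κ ∈ Δ → occ Sign.+ x (clauseTy κ) ≤ negs x Δ
negs-∈ x (here refl) = ℕ.m≤m+n _ _
negs-∈ x (there κ∈)  = ℕ.m≤n⇒m≤o+n _ (negs-∈ x κ∈)

negs-∈₂ : ∀ {n} x {κ κ′} {Δ : List (Clause n)} → κ ∈ Δ → κ′ ∈ Δ → κ ≡ κ′ ⊎
          occ Sign.+ x (clauseTy κ) + occ Sign.+ x (clauseTy κ′) ≤ negs x Δ
negs-∈₂ x (here refl) (here refl) = inj₁ refl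
negs-∈₂ x (here refl) (there κ′∈) = inj₂ (ℕ.+-monoʳ-≤ _ (negs-∈ x κ′∈))
negs-∈₂ x {κ} {κ′} (there κ∈) (here refl) = inj₂
  (ℕ.≤-trans (ℕ.≤-reflexive (ℕ.+-comm (occ Sign.+ x (clauseTy κ)) _))
      (ℕ.+-monoʳ-≤ (occ Sign.+ x (clauseTy κ′)) (negs-∈ x κ∈)))
negs-∈₂ x (there κ∈) (there κ′∈) = Sum.map₂ (ℕ.m≤n⇒m≤o+n _) (negs-∈₂ x κ∈ κ′∈)

occ-clause : ∀ {n} s x (κ : Clause n) → occ s x (clauseTy κ) ≡
             occs (opposite s) x (map subgoalTy (body κ)) + occ s x (var (head κ))
occ-clause s x (b , _) = occ-⇛ s (map subgoalTy b)

occ-head : ∀ {n} (κ : Clause n) → 1 ≤ occ Sign.+ (head κ) (clauseTy κ)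
occ-head κ = subst (1 ≤_) (sym (occ-clause Sign.+ (head κ) κ))
  (ℕ.m≤n⇒m≤o+n _ (ℕ.≤-reflexive (sym (occ-var-self (head κ)))))

linear-unique : ∀ {n} {Δ : List (Clause n)} → Linear Δ →
                ∀ {κ κ′} → κ ∈ Δ → κ′ ∈ Δ → head κ ≡ head κ′ → κ ≡ κ′
linear-unique lin {κ} {κ′} κ∈ κ′∈ eq with negs-∈₂ (head κ) κ∈ κ′∈
... | inj₁ e = e
... | inj₂ le = contradiction (ℕ.≤-trans (ℕ.+-mono-≤ (occ-head κ)
    (subst (λ x → 1 ≤ occ Sign.+ x (clauseTy κ′)) (sym eq) (occ-head κ′)))
        (ℕ.≤-trans le (lin _))) λ { (s≤s ()) }

-- The head of `κ` uses up the one negative occurrence allowed to that variable in the theory, which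
-- leaves none for any body, including that of `κ`.
linear-positive : ∀ {n} {Δ : List (Clause n)} → Linear Δ → ∀ {κ κ′} → κ ∈ Δ → κ′ ∈ Δ →
                  occs Sign.- (head κ) (map subgoalTy (body κ′)) ≡ 0
linear-positive lin {κ} {κ′} κ∈ κ′∈ with negs-∈₂ (head κ) κ∈ κ′∈
... | inj₁ refl = ℕ.n≤0⇒n≡0 (ℕ.+-cancelʳ-≤ 1 _ 0 (subst (_≤ 1)
    (trans (occ-clause Sign.+ (head κ) κ)
        (cong (occs Sign.- (head κ) (map subgoalTy (body κ)) +_) (occ-var-self (head κ))))
    (ℕ.≤-trans (negs-∈ (head κ) κ∈) (lin _))))
... | inj₂ le = ℕ.m+n≡0⇒m≡0 _ (trans (sym (occ-clause Sign.+ (head κ) κ′))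
    (ℕ.n≤0⇒n≡0 (ℕ.+-cancelˡ-≤ 1 _ 0 (ℕ.≤-trans (ℕ.+-monoˡ-≤ _ (occ-head κ))
        (ℕ.≤-trans le (lin _))))))

occs-vars : ∀ {n} {c : Fin n} {cs} → c ∈ cs → 1 ≤ occs Sign.+ c (map var cs)
occs-vars {c = c} (here refl) = ℕ.m≤n⇒m≤n+o _ (ℕ.≤-reflexive (sym (occ-var-self c)))
occs-vars (there c∈) = ℕ.m≤n⇒m≤o+n _ (occs-vars c∈)

occs-bound : ∀ {n} x {cs a} {b : List (Subgoal n)} → (cs , a) ∈ b →
             occs Sign.+ x (map var cs) ≤ occs Sign.- x (map subgoalTy b)
occs-bound x {cs} (here refl) = ℕ.m≤n⇒m≤n+o _ (subst (occs Sign.+ x (map var cs) ≤_)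
  (sym (occ-⇛ Sign.- (map var cs))) (ℕ.m≤m+n _ _))
occs-bound x (there s∈) = ℕ.m≤n⇒m≤o+n _ (occs-bound x s∈)

-- A hypothesis of a subgoal is a negative occurrence inside a body, which `linear-positive` forbids
-- for heads.
linear-unbound : ∀ {n} {Δ : List (Clause n)} → Linear Δ → ∀ {κ κ′ cs a c} →
                 κ ∈ Δ → κ′ ∈ Δ → (cs , a) ∈ body κ′ → c ∈ cs → head κ ≢ c
linear-unbound lin {κ} κ∈ κ′∈ s∈ c∈ refl = contradiction (ℕ.≤-trans (occs-vars c∈)
  (ℕ.≤-trans (occs-bound (head κ) s∈) (ℕ.≤-reflexive (linear-positive lin κ∈ κ′∈)))) λ ()

-- The hypotheses of a subgoal are atoms, so its only positive occurrence is its conclusion; the two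
-- conditions thus exclude every occurrence.
absent-subgoals : ∀ {n} {x : Fin n} b → occs Sign.- x (map subgoalTy b) ≡ 0 →
                  (∀ {cs a} → (cs , a) ∈ b → x ≢ a) → All (Absent x) (map subgoalTy b)
absent-subgoals []             p q = []
absent-subgoals {x = x} ((cs , a) ∷ b) p q =
  (λ where
    Sign.+ → trans (occ-⇛ Sign.+ (map var cs)) (cong₂ _+_
      (occs-zero Sign.- (All.map⁺ (All.universal (λ _ → refl) cs)))
          (occ-var-≢ Sign.+ (q (here refl))))
    Sign.- → ℕ.m+n≡0⇒m≡0 _ p) ∷
  absent-subgoals b (ℕ.m+n≡0⇒n≡0 (occ Sign.- x (subgoalTy (cs , a))) p) (q ∘ there)

absent-clause : ∀ {n} {x : Fin n} (κ : Clause n) → x ≢ head κ →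
    occs Sign.- x (map subgoalTy (body κ)) ≡ 0 →
                (∀ {cs a} → (cs , a) ∈ body κ → x ≢ a) → Absent x (clauseTy κ)
absent-clause {x = x} κ ne p q s = trans (occ-clause s x κ) (cong₂ _+_
  (occs-zero (opposite s) (All.map (λ h → h (opposite s)) (absent-subgoals (body κ) p q)))
      (occ-var-≢ s ne))

∈⇒↭ : ∀ {A : Set} {x : A} {xs} → x ∈ xs → ∃ λ ys → xs ↭ x ∷ ys
∈⇒↭ x∈ with ys , zs , refl ← ∈-∃++ x∈ = ys ++ zs , ↭.shift _ ys zs

filter-¬-↭ : ∀ {A : Set} {P : A → Set} (P? : Decidable P) xs →
             xs ↭ filter (¬? ∘ P?) xs ++ filter P? xs
filter-¬-↭ P? [] = ↭-refl
filter-¬-↭ P? (x ∷ xs) with P? x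
... | yes _ = ↭-trans (prep x (filter-¬-↭ P? xs)) (↭-sym (↭.shift x (filter (¬? ∘ P?) xs) _))
... | no  _ = prep x (filter-¬-↭ P? xs)

unique-heads : ∀ {n} (G : List (Clause n)) → Linear G → Unique (map head G)
unique-heads []      lin = []
unique-heads (κ ∷ G) lin =
  All.map⁺ (All.tabulate λ {κ′} κ′∈ eq → contradiction
    (ℕ.≤-trans (ℕ.+-mono-≤ (occ-head κ) (ℕ.≤-trans
      (subst (λ x → 1 ≤ occ Sign.+ x (clauseTy κ′)) (sym eq) (occ-head κ′)) (negs-∈ (head κ) κ′∈)))
      (lin (head κ))) λ { (s≤s ()) }) ∷
  unique-heads G (λ x → ℕ.≤-trans (ℕ.m≤n+m _ _) (lin x))

-- Induction on the height. `V` collects the goals visited strictly above the root clause `κ`; the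
-- other clauses split into `Γ`, with heads in `V`, and the rest `G`. Then `prune` removes `G`,
-- `resolve` consumes `κ`, and each subgoal of `κ` is left over `Γ`.
closure-theory : ∀ {n} h {Δ : List (Clause n)} {x} → Linear Δ → Derivable h Δ x →
                 ∀-closure (theoryTy Δ x) ≡Y 𝟙
closure-theory {n} (suc h) {Δ} {x} lin d@(κ , κ∈ , refl , ds) =
  ≡Y-trans (closure-cong (⇛-↭ (↭.map⁺ clauseTy Δ↭) (WF-clauses Δ) (var x)))
  (≡Y-trans (subst (λ B → ∀-closure B ≡Y ∀-closure R) split
    (prune (map head G) (map parts G) R (sym (List.map-∘ G))
      (unique-heads G linG)
      (All.map⁺ (All.universal (WF-subgoals ∘ body) G))
      (All.head (WF-clauses (κ ∷ [])) ⇒ WF-⇛ (WF-clauses Γ) (var x))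
      (All.map⁺ (All.tabulate λ κ′∈ → All.map⁺ (All.tabulate λ κ″∈ →
        occs-zero⁻ Sign.- _ (linear-positive lin (G⊆Δ κ′∈) (G⊆Δ κ″∈)))))
      (All.map⁺ (All.tabulate garbage-absent))))
  (≡Y-trans (resolve (WF-clauses Γ) (WF-subgoals (body κ))
      (All.map⁺ (All.tabulate x-absent))
      (absent-subgoals (body κ) (linear-positive lin κ∈ κ∈) λ s∈ eq → x∉V
          (subst (_∈ V) (sym eq) (sub∈V s∈))))
    (closure-⇛-∏ (WF-clauses Γ) (WF-subgoals (body κ))
      (All.map⁺ (All.tabulate premise)))))
  where
  open Deterministic Δ (linear-unique lin) (linear-unbound lin)
  V  = goals-s h ds
  V? = λ (κ : Clause n) → _∈?_ _≟_ (head κ) V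
  Δ⁻ = proj₁ (∈⇒↭ κ∈)
  G  = filter (¬? ∘ V?) Δ⁻
  Γ  = filter V? Δ⁻
  R  = clauseTy κ ⇒ theoryTy Γ x
  Δ↭ : Δ ↭ G ++ κ ∷ Γ
  Δ↭ = ↭-trans (proj₂ (∈⇒↭ κ∈)) (↭-trans (prep κ (filter-¬-↭ V? Δ⁻)) (↭-sym (↭.shift κ G Γ)))
  parts : Clause n → List (Ty n) × Fin n
  parts (b , y) = map subgoalTy b , y
  split : map implication (map parts G) ⇛ R ≡ map clauseTy (G ++ κ ∷ Γ) ⇛ var x
  split = trans (cong (_⇛ R) (sym (List.map-∘ G)))
    (trans (sym (List.foldr-++ _⇒_ (var x) (map clauseTy G) (map clauseTy (κ ∷ Γ))))
      (cong (_⇛ var x) (sym (List.map-++ clauseTy G (κ ∷ Γ)))))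
  negs-Δ : ∀ y → negs y G + (occ Sign.+ y (clauseTy κ) + negs y Γ) ≤ 1
  negs-Δ y = subst (_≤ 1) (trans (negs-↭ y Δ↭) (negs-++ y G)) (lin y)
  linG : Linear G
  linG y = ℕ.≤-trans (ℕ.m≤m+n _ _) (negs-Δ y)
  G⊆Δ : ∀ {κ′} → κ′ ∈ G → κ′ ∈ Δ
  G⊆Δ κ′∈ = ↭.∈-resp-↭ (↭-sym Δ↭) (∈-++⁺ˡ κ′∈)
  Γ⊆Δ : ∀ {κ′} → κ′ ∈ Γ → κ′ ∈ Δ
  Γ⊆Δ κ′∈ = ↭.∈-resp-↭ (↭-sym Δ↭) (∈-++⁺ʳ G (there κ′∈))
  x∉V : x ∉ V
  x∉V = goal∉subgoals h κ∈ ds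
  Γ-heads : ∀ {κ′} → κ′ ∈ Γ → head κ′ ∈ V
  Γ-heads κ′∈ = proj₂ (∈-filter⁻ V? {xs = Δ⁻} κ′∈)
  sub∈V : ∀ {cs a} → (cs , a) ∈ body κ → a ∈ V
  sub∈V s∈ = goals⊆goals-s h ds s∈ (goal∈goals h (All.lookup ds s∈))
  closed : ∀ {κ′ cs a} → κ′ ∈ Γ → (cs , a) ∈ body κ′ → a ∈ V
  closed κ′∈ s∈ = goals-s-closed h (extends-facts inj₁ κ∈) ds (Γ⊆Δ κ′∈) (Γ-heads κ′∈) s∈
  x-absent : ∀ {κ′} → κ′ ∈ Γ → Absent x (clauseTy κ′)
  x-absent {κ′} κ′∈ = absent-clause κ′ (λ eq → x∉V (subst (_∈ V) (sym eq) (Γ-heads κ′∈)))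
    (linear-positive lin κ∈ (Γ⊆Δ κ′∈)) (λ s∈ eq → x∉V (subst (_∈ V) (sym eq) (closed κ′∈ s∈)))
  -- Heads and subgoal conclusions in `R` are visited or equal to `x`. The head of `κ′` is neither,
  -- since `κ` already heads `x`; linearity rules out the hypotheses of subgoals.
  garbage-absent : ∀ {κ′} → κ′ ∈ G → Absent (head κ′) R
  garbage-absent {κ′} κ′∈ s = cong₂ _+_
    (absent-clause κ y≢x (linear-positive lin (G⊆Δ κ′∈) κ∈) (λ s∈ → y≢ (sub∈V s∈)) (opposite s))
    (trans (occ-⇛ s (map clauseTy Γ)) (cong₂ _+_
      (occs-zero (opposite s) (All.map⁺ (All.tabulate λ {κ″} κ″∈ →
        absent-clause κ″ (y≢ (Γ-heads κ″∈)) (linear-positive lin (G⊆Δ κ′∈) (Γ⊆Δ κ″∈))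
            (λ s∈ → y≢ (closed κ″∈ s∈)) (opposite s))))
      (occ-var-≢ s y≢x)))
    where
    y∉V : head κ′ ∉ V
    y∉V = proj₂ (∈-filter⁻ (¬? ∘ V?) {xs = Δ⁻} κ′∈)
    y≢ : ∀ {a} → a ∈ V → head κ′ ≢ a
    y≢ a∈ eq = y∉V (subst (_∈ V) (sym eq) a∈)
    y≢x : head κ′ ≢ x
    y≢x eq = contradiction (ℕ.≤-trans (ℕ.+-mono-≤
        (ℕ.≤-trans (subst (λ y → 1 ≤ occ Sign.+ y (clauseTy κ′)) eq (occ-head κ′)) (negs-∈ x κ′∈))
        (ℕ.≤-trans (occ-head κ) (ℕ.m≤m+n _ _))) (negs-Δ x)) λ { (s≤s ()) }
  -- The hypotheses `cs` of the subgoal join the theory as facts, and the subderivation is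
  -- transported to the smaller theory.
  premise : ∀ {s} → s ∈ body κ → ∀-closure (map clauseTy Γ ⇛ subgoalTy s) ≡Y 𝟙
  premise {cs , a} s∈ = ≡Y-trans
    (closure-cong (subst₂ _≡Y_ (List.foldr-++ _⇒_ (var a) (map clauseTy Γ) (map var cs)) eq
      (⇛-↭ (↭.++-comm (map clauseTy Γ) (map var cs)) (All.++⁺ (WF-clauses Γ) (WF-vars cs))
          (var a))))
    (closure-theory h {facts cs ++ Γ} lin′
      (transport h (All.lookup ds s∈) (++-monoʳ (facts cs)
          (λ κ′∈ y∈ → keep κ′∈ (goals⊆goals-s h ds s∈ y∈)))))
    where
    eq : (map var cs ++ map clauseTy Γ) ⇛ var a ≡ theoryTy (facts cs ++ Γ) a
    eq = cong (_⇛ var a) (trans (cong (_++ map clauseTy Γ) (List.map-∘ cs))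
        (sym (List.map-++ clauseTy (facts cs) Γ)))
    keep : ∀ {κ′} → κ′ ∈ Δ → head κ′ ∈ V → κ′ ∈ Γ
    keep κ′∈ y∈ with ↭.∈-resp-↭ (proj₂ (∈⇒↭ κ∈)) κ′∈
    ... | here refl = contradiction y∈ x∉V
    ... | there κ′∈Δ⁻ = ∈-filter⁺ V? κ′∈Δ⁻ y∈
    -- The facts take over occurrences that were counted in the body of `κ`, which has left the
    -- theory.
    lin′ : Linear (facts cs ++ Γ)
    lin′ y = ℕ.≤-trans (ℕ.≤-reflexive (trans (negs-++ y (facts cs))
        (cong (λ As → occs Sign.+ y As + negs y Γ) (sym (List.map-∘ cs)))))
      (ℕ.≤-trans (ℕ.+-monoˡ-≤ (negs y Γ) (ℕ.≤-trans (occs-bound y s∈)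
          (subst (occs Sign.- y (map subgoalTy (body κ)) ≤_) (sym (occ-clause Sign.+ y κ))
              (ℕ.m≤m+n _ _))))
        (ℕ.≤-trans (ℕ.m≤n+m _ (negs y G)) (negs-Δ y)))

-- Kripke semantics

record Frame : Set₁ where
  infix 4 _≼_
  field
    World   : Set
    _≼_     : World → World → Set
    ≼-refl  : ∀ {w} → w ≼ w
    ≼-trans : ∀ {u v w} → u ≼ v → v ≼ w → u ≼ w

module Semantics (F : Frame) where
  open Frame F

  Valuation : ℕ → Set₁
  Valuation n = Fin n → World → Set

  Monotone : ∀ {n} → Valuation n → Set
  Monotone V = ∀ x {u w} → u ≼ w → V x u → V x w

  Forces : ∀ {n} → Valuation n → World → Simple n → Set
  Forces V w (var x) = V x w
  Forces V w (A ⇒ B) = ∀ {u} → w ≼ u → Forces V u A → Forces V u B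

  forces-mono : ∀ {n} {V : Valuation n} → Monotone V → ∀ A {u w} → u ≼ w → Forces V u A →
      Forces V w A
  forces-mono m (var x) u≼w f = m x u≼w f
  forces-mono m (A ⇒ B) u≼w f w≼v = f (≼-trans u≼w w≼v)

  sound : ∀ {n} {V : Valuation n} → Monotone V → ∀ {Γ A w} → Γ ⊢ A → All (Forces V w) Γ →
      Forces V w A
  sound m (var A∈) γ = All.lookup γ A∈
  sound m (ƛ t)    γ w≼u a = sound m t (a ∷ All.map (λ {A} → forces-mono m A w≼u) γ)
  sound m (t · u)  γ = sound m t γ ≼-refl (sound m u γ)

  ForcesSubgoal : ∀ {n} → Valuation n → World → Subgoal n → Set
  ForcesSubgoal V w (cs , a) = ∀ u → w ≼ u → All (λ c → V c u) cs → V a u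

  -- Truth is required at all worlds, so the outer implications need no passage to a later world.
  TrueClause : ∀ {n} → Valuation n → Clause n → Set
  TrueClause V (b , x) = ∀ w → All (ForcesSubgoal V w) b → V x w

-- Naming subformulas

-- An item relates the name x of a subformula to the subformula A, which is still
-- to be decomposed: neg x A is x ⇒ A, and pos A x is A ⇒ x.
data Item (m n : ℕ) : Set where
  neg : Fin n → Simple m → Item m n
  pos : Simple m → Fin n → Item m n

up : ∀ {m n} → (Fin m → Fin n) → Fin m → Fin (suc n)
up ρ x = suc (ρ x)

-- The map `ρ` places the original variables in the current context, so that a simple type stays
-- unchanged while fresh names are added.
embed : ∀ {m n} → (Fin m → Fin n) → Simple m → Ty n
embed ρ (var x) = var (ρ x)
embed ρ (A ⇒ B) = embed ρ A ⇒ embed ρ B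

itemTy : ∀ {m n} → (Fin m → Fin n) → Item m n → Ty n
itemTy ρ (neg x A) = var x ⇒ embed ρ A
itemTy ρ (pos A x) = embed ρ A ⇒ var x

weakenItem : ∀ {m n} → Item m n → Item m (suc n)
weakenItem (neg x A) = neg (suc x) A
weakenItem (pos A x) = pos A (suc x)

weakenSubgoal : ∀ {n} → Subgoal n → Subgoal (suc n)
weakenSubgoal (cs , a) = map suc cs , suc a

weakenClause : ∀ {n} → Clause n → Clause (suc n)
weakenClause (b , x) = map weakenSubgoal b , suc x

-- A variable counts 1, so turning an atomic item into a clause lowers the total; an arrow counts
-- one more than its two sides together, so splitting it into two items does too.
size : ∀ {m} → Simple m → ℕ
size (var x) = 1
size (A ⇒ B) = suc (size A + size B)

itemSize : ∀ {m n} → Item m n → ℕ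
itemSize (neg x A) = size A
itemSize (pos A x) = size A

sizes : ∀ {m n} → List (Item m n) → ℕ
sizes [] = 0
sizes (i ∷ is) = itemSize i + sizes is

sizes-weaken : ∀ {m n} (is : List (Item m n)) → sizes (map weakenItem is) ≡ sizes is
sizes-weaken [] = refl
sizes-weaken (neg x A ∷ is) = cong (size A +_) (sizes-weaken is)
sizes-weaken (pos A x ∷ is) = cong (size A +_) (sizes-weaken is)

weaken² : ∀ {n} → Ty n → Ty (suc (suc n))
weaken² A = weaken (weaken A)

weaken-var : ∀ {n} (x : Fin n) → weaken (var x) ≡ var (suc x)
weaken-var x = cong var (VarLemmas.lookup-wk x)

weaken-embed : ∀ {m n} (ρ : Fin m → Fin n) A → weaken (embed ρ A) ≡ embed (up ρ) A
weaken-embed ρ (var x) = weaken-var (ρ x)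
weaken-embed ρ (A ⇒ B) = cong₂ _⇒_ (weaken-embed ρ A) (weaken-embed ρ B)

weaken²-var : ∀ {n} (x : Fin n) → weaken² (var x) ≡ var (suc (suc x))
weaken²-var x = trans (cong weaken (weaken-var x)) (weaken-var (suc x))

weaken²-embed : ∀ {m n} (ρ : Fin m → Fin n) A → weaken² (embed ρ A) ≡ embed (up (up ρ)) A
weaken²-embed ρ A = trans (cong weaken (weaken-embed ρ A)) (weaken-embed (up ρ) A)

weaken-item : ∀ {m n} (ρ : Fin m → Fin n) i → weaken (itemTy ρ i) ≡ itemTy (up ρ) (weakenItem i)
weaken-item ρ (neg x A) = cong₂ _⇒_ (weaken-var x) (weaken-embed ρ A)
weaken-item ρ (pos A x) = cong₂ _⇒_ (weaken-embed ρ A) (weaken-var x)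

weaken-⇛ : ∀ {A : Set} {n} {f : A → Ty n} {B : Set} {g : B → Ty (suc n)} {h : A → B} →
           (∀ a → weaken (f a) ≡ g (h a)) → ∀ as {C D} → weaken C ≡ D →
           weaken (map f as ⇛ C) ≡ map g (map h as) ⇛ D
weaken-⇛ e []       eq = eq
weaken-⇛ e (a ∷ as) eq = cong₂ _⇒_ (e a) (weaken-⇛ e as eq)

weaken-subgoal : ∀ {n} (s : Subgoal n) → weaken (subgoalTy s) ≡ subgoalTy (weakenSubgoal s)
weaken-subgoal (cs , a) = weaken-⇛ weaken-var cs (weaken-var a)

weaken-clause : ∀ {n} (κ : Clause n) → weaken (clauseTy κ) ≡ clauseTy (weakenClause κ)
weaken-clause (b , x) = weaken-⇛ weaken-subgoal b (weaken-var x)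

stateTy : ∀ {m n} → (Fin m → Fin n) → List (Item m n) → List (Clause n) → Fin n → Ty n
stateTy ρ is Δ x = map (itemTy ρ) is ⇛ theoryTy Δ x

weaken-state : ∀ {m n} (ρ : Fin m → Fin n) is Δ x → weaken (stateTy ρ is Δ x) ≡
               stateTy (up ρ) (map weakenItem is) (map weakenClause Δ) (suc x)
weaken-state ρ is Δ x = weaken-⇛ (weaken-item ρ) is (weaken-⇛ weaken-clause Δ (weaken-var x))

WF-embed : ∀ {m n} (ρ : Fin m → Fin n) A → WF (embed ρ A)
WF-embed ρ (var x) = var (ρ x)
WF-embed ρ (A ⇒ B) = WF-embed ρ A ⇒ WF-embed ρ B

WF-item : ∀ {m n} (ρ : Fin m → Fin n) i → WF (itemTy ρ i)
WF-item ρ (neg x A) = var x ⇒ WF-embed ρ A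
WF-item ρ (pos A x) = WF-embed ρ A ⇒ var x

WF-items : ∀ {m n} (ρ : Fin m → Fin n) is → All WF (map (itemTy ρ) is)
WF-items ρ is = All.map⁺ (All.universal (WF-item ρ) is)

WF-theory : ∀ {n} (Δ : List (Clause n)) x → WF (theoryTy Δ x)
WF-theory Δ x = WF-⇛ (WF-clauses Δ) (var x)

WF-state : ∀ {m n} (ρ : Fin m → Fin n) is Δ x → WF (stateTy ρ is Δ x)
WF-state ρ is Δ x = WF-⇛ (WF-items ρ is) (WF-theory Δ x)

⇛-move : ∀ {n} {As} {B C : Ty n} → All WF As → WF B → WF C → As ⇛ (B ⇒ C) ≡Y B ⇒ (As ⇛ C)
⇛-move []       b c = ≡Y-refl (b ⇒ c)
⇛-move (a ∷ as) b c = ≡Y-trans (⇒-cong (≡Y-refl a) (⇛-move as b c))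
  (axiom (a ⇒ b ⇒ WF-⇛ as c) (b ⇒ a ⇒ WF-⇛ as c) (⇒-swap _ _ _))

occ-move : ∀ {n} s {x : Fin n} As {B C} → occ s x (As ⇛ (B ⇒ C)) ≡ occ s x (B ⇒ (As ⇛ C))
occ-move s []       = refl
occ-move s {x} (A ∷ As) {B} {C} = trans (cong (occ (opposite s) x A +_) (occ-move s As))
  (lem (occ (opposite s) x A) (occ (opposite s) x B) (occ s x (As ⇛ C)))
  where
  lem : ∀ a b c → a + (b + c) ≡ b + (a + c)
  lem = solve-∀

LinearTy : ∀ {n} → Ty n → Set
LinearTy A = ∀ x → occ Sign.- x A ≤ 1

-- Variables 0 and 1 name `B` and `A` in `named-⇒`, but `A` and `B` in `named-⇒⇒`. Of the two
-- implications between a name and its subformula only the one fitting the polarity is kept: 0 is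
-- eliminated by (Y-) and 1 by (Y+).
named-⇒ named-⇒⇒ : ∀ {n} → Ty (2 + n) → Ty (2 + n) → Ty (2 + n) → Ty (2 + n) → Ty (2 + n)
named-⇒  V A B C = (var zero ⇒ B) ⇒ (A ⇒ var (suc zero)) ⇒ (V ⇒ var (suc zero) ⇒ var zero) ⇒ C
named-⇒⇒ V A B C = (var zero ⇒ A) ⇒ (B ⇒ var (suc zero)) ⇒ ((var zero ⇒ var (suc zero)) ⇒ V) ⇒ C

name-⇒ : ∀ {n} {V A B C : Ty n} → WF V → WF A → WF B → WF C →
  ∀′ (∀′ (named-⇒ (weaken² V) (weaken² A) (weaken² B) (weaken² C)))
    ≡Y (V ⇒ A ⇒ B) ⇒ C
name-⇒ {V = V} {A} {B} {C} v a b c = ≡Y-trans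
    (∀-cong (subst (∀′ ((var zero ⇒ weaken² B) ⇒ D) ≡Y_) eq₁
    (name⁻ (weaken B) D (WF-ren b) wD negD)))
  (subst (∀′ ((weaken A ⇒ var zero) ⇒ E) ≡Y_) eq₂ (name⁺ A E a wE posE))
  where
  D = (weaken² A ⇒ var (suc zero)) ⇒ (weaken² V ⇒ var (suc zero) ⇒ var zero) ⇒ weaken² C
  E = (weaken V ⇒ var zero ⇒ weaken B) ⇒ weaken C
  wD = (WF-ren (WF-ren a) ⇒ var _) ⇒ (WF-ren (WF-ren v) ⇒ var _ ⇒ var _) ⇒ WF-ren (WF-ren c)
  wE = (WF-ren v ⇒ var _ ⇒ WF-ren b) ⇒ WF-ren c
  negD : OnlyNegative zero D
  negD rewrite occ-weaken-zero Sign.+ (weaken A) | occ-weaken-zero Sign.+ (weaken V)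
      | occ-weaken-zero Sign.+ (weaken C) = refl
  posE : OnlyPositive zero E
  posE rewrite occ-weaken-zero Sign.- V | occ-weaken-zero Sign.+ B | occ-weaken-zero Sign.- C = refl
  eq₁ : D / sub (weaken B) ≡ (weaken A ⇒ var zero) ⇒ E
  eq₁ rewrite weaken-sub (weaken A) {weaken B} | weaken-sub (weaken V) {weaken B} | weaken-sub
      (weaken C) {weaken B} = refl
  eq₂ : E / sub A ≡ (V ⇒ A ⇒ B) ⇒ C
  eq₂ rewrite weaken-sub V {A} | weaken-sub B {A} | weaken-sub C {A} = refl

name-⇒⇒ : ∀ {n} {V A B C : Ty n} → WF V → WF A → WF B → WF C →
  ∀′ (∀′ (named-⇒⇒ (weaken² V) (weaken² A) (weaken² B) (weaken² C)))
    ≡Y ((A ⇒ B) ⇒ V) ⇒ C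
name-⇒⇒ {V = V} {A} {B} {C} v a b c = ≡Y-trans
    (∀-cong (subst (∀′ ((var zero ⇒ weaken² A) ⇒ D) ≡Y_) eq₁
    (name⁻ (weaken A) D (WF-ren a) wD negD)))
  (subst (∀′ ((weaken B ⇒ var zero) ⇒ E) ≡Y_) eq₂ (name⁺ B E b wE posE))
  where
  D = (weaken² B ⇒ var (suc zero)) ⇒ ((var zero ⇒ var (suc zero)) ⇒ weaken² V) ⇒ weaken² C
  E = ((weaken A ⇒ var zero) ⇒ weaken V) ⇒ weaken C
  wD = (WF-ren (WF-ren b) ⇒ var _) ⇒ ((var _ ⇒ var _) ⇒ WF-ren (WF-ren v)) ⇒ WF-ren (WF-ren c)
  wE = ((WF-ren a ⇒ var _) ⇒ WF-ren v) ⇒ WF-ren c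
  negD : OnlyNegative zero D
  negD rewrite occ-weaken-zero Sign.+ (weaken B) | occ-weaken-zero Sign.- (weaken V)
      | occ-weaken-zero Sign.+ (weaken C) = refl
  posE : OnlyPositive zero E
  posE rewrite occ-weaken-zero Sign.+ A | occ-weaken-zero Sign.+ V | occ-weaken-zero Sign.- C = refl
  eq₁ : D / sub (weaken A) ≡ (weaken B ⇒ var zero) ⇒ E
  eq₁ rewrite weaken-sub (weaken B) {weaken A} | weaken-sub (weaken V) {weaken A} | weaken-sub
      (weaken C) {weaken A} = refl
  eq₂ : E / sub B ≡ ((A ⇒ B) ⇒ V) ⇒ C
  eq₂ rewrite weaken-sub V {B} | weaken-sub A {B} | weaken-sub C {B} = refl

occ-weaken² : ∀ {n} s (x : Fin n) A → occ s (suc (suc x)) (weaken² A) ≡ occ s x A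
occ-weaken² s x A = trans (occ-weaken s (suc x) (weaken A)) (occ-weaken s x A)

occ-weaken²-one : ∀ {n} s (A : Ty n) → occ s (suc zero) (weaken² A) ≡ 0
occ-weaken²-one s A = trans (occ-weaken s zero (weaken A)) (occ-weaken-zero s A)

-- Each fresh name has exactly one negative occurrence, and the counts of the old variables are
-- merely rearranged.
linear-name-⇒ : ∀ {n} (V A B C : Ty n) → LinearTy ((V ⇒ A ⇒ B) ⇒ C) →
  LinearTy (named-⇒ (weaken² V) (weaken² A) (weaken² B) (weaken² C))
linear-name-⇒ V A B C lin zero
  rewrite occ-weaken-zero Sign.+ (weaken B) | occ-weaken-zero Sign.- (weaken A)
        | occ-weaken-zero Sign.- (weaken V) | occ-weaken-zero Sign.- (weaken C) = ℕ.≤-refl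
linear-name-⇒ V A B C lin (suc zero)
  rewrite occ-weaken²-one Sign.+ B | occ-weaken²-one Sign.- A
        | occ-weaken²-one Sign.- V | occ-weaken²-one Sign.- C = ℕ.≤-refl
linear-name-⇒ V A B C lin (suc (suc x))
  rewrite occ-weaken² Sign.+ x B | occ-weaken² Sign.- x A
        | occ-weaken² Sign.- x V | occ-weaken² Sign.- x C =
  subst (_≤ 1) (lem (occ Sign.- x V) (occ Sign.- x A) (occ Sign.+ x B) (occ Sign.- x C)) (lin x)
  where
  lem : ∀ v a b c → v + (a + b) + c ≡ b + (a + 0 + (v + 0 + c))
  lem = solve-∀

linear-name-⇒⇒ : ∀ {n} (V A B C : Ty n) → LinearTy (((A ⇒ B) ⇒ V) ⇒ C) →
  LinearTy (named-⇒⇒ (weaken² V) (weaken² A) (weaken² B) (weaken² C))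
linear-name-⇒⇒ V A B C lin zero
  rewrite occ-weaken-zero Sign.+ (weaken A) | occ-weaken-zero Sign.- (weaken B)
        | occ-weaken-zero Sign.+ (weaken V) | occ-weaken-zero Sign.- (weaken C) = ℕ.≤-refl
linear-name-⇒⇒ V A B C lin (suc zero)
  rewrite occ-weaken²-one Sign.+ A | occ-weaken²-one Sign.- B
        | occ-weaken²-one Sign.+ V | occ-weaken²-one Sign.- C = ℕ.≤-refl
linear-name-⇒⇒ V A B C lin (suc (suc x))
  rewrite occ-weaken² Sign.+ x A | occ-weaken² Sign.- x B
        | occ-weaken² Sign.+ x V | occ-weaken² Sign.- x C =
  subst (_≤ 1) (lem (occ Sign.+ x V) (occ Sign.+ x A) (occ Sign.- x B) (occ Sign.- x C)) (lin x)
  where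
  lem : ∀ v a b c → a + b + v + c ≡ a + (b + 0 + (v + c))
  lem = solve-∀

-- Semantic consequence and the canonical model

module _ (F : Frame) where
  open Frame F
  open Semantics F

  TrueItem : ∀ {m n} → (Fin m → Fin n) → Valuation n → Item m n → Set
  TrueItem ρ V (neg x A) = ∀ {w} → V x w → Forces (V ∘ ρ) w A
  TrueItem ρ V (pos A x) = ∀ {w} → Forces (V ∘ ρ) w A → V x w

  true-items-weaken : ∀ {m n} {ρ : Fin m → Fin n} {V} is →
    All (TrueItem (up ρ) V) (map weakenItem is) → All (TrueItem ρ (V ∘ suc)) is
  true-items-weaken []             []       = []
  true-items-weaken (neg _ _ ∷ is) (t ∷ ts) = t ∷ true-items-weaken is ts
  true-items-weaken (pos _ _ ∷ is) (t ∷ ts) = t ∷ true-items-weaken is ts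

  true-clauses-weaken : ∀ {n} {V : Valuation (suc n)} Δ →
    All (TrueClause V) (map weakenClause Δ) → All (TrueClause (V ∘ suc)) Δ
  true-clauses-weaken Δ ts = All.map
    (λ t w ss → t w (All.map⁺ (All.map (λ s u w≼u cs → s u w≼u (All.map⁻ cs)) ss))) (All.map⁻ ts)

-- Inhabitation is carried through the naming as consequence in all Kripke models, so that no λ-term
-- has to be transformed or normalised; a derivation is recovered from the canonical model once only
-- clauses remain.
Entails : ∀ {m n} → (Fin m → Fin n) → List (Item m n) → List (Clause n) → Fin n → Set₁
Entails ρ is Δ x = ∀ (F : Frame) → let open Semantics F in ∀ V → Monotone V →
  All (TrueItem F ρ V) is → All (TrueClause V) Δ → ∀ w → V x w

-- The canonical model: sets of additional clauses, ordered by inclusion.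
contexts : ℕ → Frame
contexts n = record
  { World   = List (Clause n)
  ; _≼_     = λ Γ Δ → ∀ {κ} → κ ∈ Γ → κ ∈ Δ
  ; ≼-refl  = id
  ; ≼-trans = λ p q → q ∘ p
  }

derivable-≤ : ∀ {n} {h k} {Δ : List (Clause n)} {x} → h ≤′ k → Derivable h Δ x → Derivable k Δ x
derivable-≤ ≤′-refl      d = d
derivable-≤ (≤′-step le) d = derivable-suc _ (derivable-≤ le d)

common-height : ∀ {n} {Δ : List (Clause n)} {b} →
    All (λ (cs , a) → ∃ λ h → Derivable h (facts cs ++ Δ) a) b →
                ∃ λ h → Derivables h Δ b
common-height [] = 0 , []
common-height ((h , d) ∷ ds) = let k , es = common-height ds in h ⊔ k ,
  derivable-≤ (ℕ.≤⇒≤′ (ℕ.m≤m⊔n h k)) d ∷ All.map (derivable-≤ (ℕ.≤⇒≤′ (ℕ.m≤n⊔m h k))) es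

-- Let `x` hold at `Γ` when it is derivable from `Γ ++ Δ`. The clauses of `Δ` are true under this
-- valuation, and the entailed goal at the empty world is the required derivation.
entails⇒derivable : ∀ {m n} {ρ : Fin m → Fin n} {Δ x} → Entails ρ [] Δ x → ∃ λ h → Derivable h Δ x
entails⇒derivable {n = n} {Δ = Δ} entails = entails (contexts n) V mono [] (All.tabulate valid) []
  where
  open Semantics (contexts n)
  V : Valuation n
  V x Γ = ∃ λ h → Derivable h (Γ ++ Δ) x
  enlarge : ∀ {Γ Γ′} → (∀ {κ} → κ ∈ Γ → κ ∈ Γ′) → ∀ {κ} → κ ∈ Γ ++ Δ → κ ∈ Γ′ ++ Δ
  enlarge {Γ} {Γ′} p κ∈ = Sum.[ ∈-++⁺ˡ ∘ p , ∈-++⁺ʳ Γ′ ]′ (∈-++⁻ Γ κ∈)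
  mono : Monotone V
  mono x p (h , d) = h , derivable-⊆ h (enlarge p) d
  valid : ∀ {κ} → κ ∈ Δ → TrueClause V κ
  valid {κ} κ∈ Γ ss =
    let h , ds = common-height (All.map (λ {s} → premise {s}) ss)
    in suc h , κ , ∈-++⁺ʳ Γ κ∈ , refl , ds
    where
    premise : ∀ {s} → ForcesSubgoal V Γ s →
              ∃ λ h → Derivable h (facts (proj₁ s) ++ Γ ++ Δ) (proj₂ s)
    premise {cs , a} f = subst (λ Γ′ → ∃ λ h → Derivable h Γ′ a) (List.++-assoc (facts cs) Γ Δ)
      -- The forced subgoal is used at the world enlarged by its own hypotheses, each of which is
      -- derivable there at height 1 as a fact.
      (f (facts cs ++ Γ) (∈-++⁺ʳ (facts cs))
        (All.tabulate λ c∈ → 1 , _ , ∈-++⁺ˡ (∈-++⁺ˡ (∈-map⁺ ([] ,_) c∈)) , refl , []))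

-- Induction on a bound `k` for the total size of the items, since decomposing one item produces
-- two. When none is left, the state is a theory that derives its goal.
closure-state : ∀ k {m n} (ρ : Fin m → Fin n) is Δ x → sizes is ≤ k →
                LinearTy (stateTy ρ is Δ x) → Entails ρ is Δ x → ∀-closure (stateTy ρ is Δ x) ≡Y 𝟙

-- An atomic item is already a clause, with a single subgoal without hypotheses, and only has to be
-- moved past the other items.
closure-atom : ∀ k {m n} (ρ : Fin m → Fin n) is Δ x y z → sizes is ≤ k →
               LinearTy ((var y ⇒ var z) ⇒ stateTy ρ is Δ x) →
               Entails ρ is (((([] , y) ∷ []) , z) ∷ Δ) x →
               ∀-closure ((var y ⇒ var z) ⇒ stateTy ρ is Δ x) ≡Y 𝟙
closure-atom k ρ is Δ x y z le lin ent = ≡Y-trans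
  (closure-cong (≡Y-sym (⇛-move (WF-items ρ is) (var y ⇒ var z) (WF-theory Δ x))))
  (closure-state k ρ is ((([] , y) ∷ [] , z) ∷ Δ) x le
    (λ v → subst (_≤ 1) (sym (occ-move Sign.- (map (itemTy ρ) is))) (lin v)) ent)

-- Common to both decompositions: the quantifiers of the two names are absorbed into the closure,
-- and the new clause is moved past the old items into the theory.
closure-compound : ∀ k {m n} (ρ : Fin m → Fin n) is Δ x {A : Ty n} i j κ →
    itemSize i + (itemSize j + sizes is) ≤ k →
  let ρ′  = up (up ρ)
      is′ = map weakenItem (map weakenItem is)
      Δ′  = map weakenClause (map weakenClause Δ)
      x′  = suc (suc x)
      new = itemTy ρ′ i ⇒ itemTy ρ′ j ⇒ clauseTy κ ⇒ weaken² (stateTy ρ is Δ x)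
  in ∀′ (∀′ new) ≡Y A ⇒ stateTy ρ is Δ x → LinearTy new →
     Entails ρ′ (i ∷ j ∷ is′) (κ ∷ Δ′) x′ → ∀-closure (A ⇒ stateTy ρ is Δ x) ≡Y 𝟙
closure-compound k ρ is Δ x i j κ le eq lin ent = ≡Y-trans
  (closure-cong (≡Y-trans (≡Y-sym eq) (∀-cong
      (∀-cong (⇒-cong (≡Y-refl (WF-item ρ′ i)) (⇒-cong (≡Y-refl (WF-item ρ′ j))
    (subst (λ T → clauseTy κ ⇒ T ≡Y map (itemTy ρ′) is′ ⇛ (clauseTy κ ⇒ theoryTy Δ′ x′)) (sym state)
      (≡Y-sym (⇛-move (WF-items ρ′ is′) (All.head (WF-clauses (κ ∷ []))) (WF-theory Δ′ x′))))))))))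
  (closure-state k ρ′ (i ∷ j ∷ is′) (κ ∷ Δ′) x′
    (subst (λ l → itemSize i + (itemSize j + l) ≤ k)
      (sym (trans (sizes-weaken (map weakenItem is)) (sizes-weaken is))) le)
    (λ v → subst (_≤ 1) (cong (λ o → occ Sign.+ v (itemTy ρ′ i) + (occ Sign.+ v (itemTy ρ′ j) + o))
      (trans (cong (λ T → occ Sign.- v (clauseTy κ ⇒ T)) state)
          (sym (occ-move Sign.- (map (itemTy ρ′) is′))))) (lin v))
    ent)
  where
  ρ′  = up (up ρ)
  is′ = map weakenItem (map weakenItem is)
  Δ′  = map weakenClause (map weakenClause Δ)
  x′  = suc (suc x)
  state : weaken² (stateTy ρ is Δ x) ≡ stateTy ρ′ is′ Δ′ x′
  state = trans (cong weaken (weaken-state ρ is Δ x))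
                (weaken-state (up ρ) (map weakenItem is) (map weakenClause Δ) (suc x))

closure-state k ρ [] Δ x le lin ent =
  let h , d = entails⇒derivable ent
  in closure-theory h (λ y → subst (_≤ 1)
       (trans (occ-⇛ Sign.- (map clauseTy Δ)) (ℕ.+-identityʳ (negs y Δ))) (lin y)) d
closure-state (suc k) ρ (neg y (var z) ∷ is) Δ x (s≤s le) lin ent =
  closure-atom k ρ is Δ x y (ρ z) le lin λ where
    F V m ts (t ∷ us) → ent F V m ((λ {w} v → t w ((λ u w≼u [] → m y w≼u v) ∷ [])) ∷ ts) us
closure-state (suc k) ρ (pos (var z) y ∷ is) Δ x (s≤s le) lin ent =
  closure-atom k ρ is Δ x (ρ z) y le lin λ where
    F V m ts (t ∷ us) → ent F V m ((λ {w} v → t w ((λ u w≼u [] → m (ρ z) w≼u v) ∷ [])) ∷ ts) us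
closure-state (suc k) {n = n} ρ (neg y (A ⇒ B) ∷ is) Δ x (s≤s le) lin ent =
  closure-compound k ρ is Δ x (neg zero B) (pos A (suc zero))
    ((([] , suc (suc y)) ∷ ([] , suc zero) ∷ []) , zero)
    (ℕ.≤-trans (ℕ.≤-reflexive (lem (size A) (size B) (sizes is))) le)
    (subst (_≡Y (itemTy ρ (neg y (A ⇒ B)) ⇒ stateTy ρ is Δ x)) (cong (λ T → ∀′ (∀′ T)) new≡)
        (name-⇒ (var y) (WF-embed ρ A) (WF-embed ρ B) (WF-state ρ is Δ x)))
    (subst LinearTy new≡ (linear-name-⇒ (var y) (embed ρ A) (embed ρ B) (stateTy ρ is Δ x) lin))
    λ where
      -- Forgetting the two names turns a model of the new state into one of the old; the item
      -- `y ⇒ A ⇒ B` is recovered by chaining `A ⇒ 1`, the new clause and `0 ⇒ B`.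
      F V m (tb ∷ ta ∷ ts) (t ∷ us) w →
        ent F (λ i → V (suc (suc i))) (λ i → m (suc (suc i)))
          ((λ vy w≼u a → tb (t _ ((λ v u≼v [] → m _ u≼v (m _ w≼u vy)) ∷
              (λ v u≼v [] → m _ u≼v (ta a)) ∷ []))) ∷
           true-items-weaken F is (true-items-weaken F (map weakenItem is) ts))
          (true-clauses-weaken F Δ (true-clauses-weaken F (map weakenClause Δ) us)) w
  where
  lem : ∀ a b c → b + (a + c) ≡ a + b + c
  lem = solve-∀
  R = weaken² (stateTy ρ is Δ x)
  new≡ : named-⇒ (weaken² (var y)) (weaken² (embed ρ A)) (weaken² (embed ρ B)) R ≡
         named-⇒ (var (suc (suc y))) (embed (up (up ρ)) A) (embed (up (up ρ)) B) R
  new≡ rewrite weaken²-embed ρ A | weaken²-embed ρ B | weaken²-var y = refl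
closure-state (suc k) {n = n} ρ (pos (A ⇒ B) y ∷ is) Δ x (s≤s le) lin ent =
  closure-compound k ρ is Δ x (neg zero A) (pos B (suc zero))
    ((((zero ∷ []) , suc zero) ∷ []) , suc (suc y))
    (ℕ.≤-trans (ℕ.≤-reflexive (sym (ℕ.+-assoc (size A) (size B) (sizes is)))) le)
    (subst (_≡Y (itemTy ρ (pos (A ⇒ B) y) ⇒ stateTy ρ is Δ x)) (cong (λ T → ∀′ (∀′ T)) new≡)
        (name-⇒⇒ (var y) (WF-embed ρ A) (WF-embed ρ B) (WF-state ρ is Δ x)))
    (subst LinearTy new≡ (linear-name-⇒⇒ (var y) (embed ρ A) (embed ρ B) (stateTy ρ is Δ x) lin))
    λ where
      -- Here `0 ⇒ A`, a forced `A ⇒ B` and `B ⇒ 1` compose to the subgoal `0 ⇒ 1` of the new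
      -- clause, whose head is `y`.
      F V m (ta ∷ tb ∷ ts) (t ∷ us) w →
        ent F (λ i → V (suc (suc i))) (λ i → m (suc (suc i)))
          ((λ {w} f → t w ((λ { u w≼u (va ∷ []) → tb (f w≼u (ta va)) }) ∷ [])) ∷
           true-items-weaken F is (true-items-weaken F (map weakenItem is) ts))
          (true-clauses-weaken F Δ (true-clauses-weaken F (map weakenClause Δ) us)) w
  where
  R = weaken² (stateTy ρ is Δ x)
  new≡ : named-⇒⇒ (weaken² (var y)) (weaken² (embed ρ A)) (weaken² (embed ρ B)) R ≡
         named-⇒⇒ (var (suc (suc y))) (embed (up (up ρ)) A) (embed (up (up ρ)) B) R
  new≡ rewrite weaken²-embed ρ A | weaken²-embed ρ B | weaken²-var y = refl

-- Inhabited simple types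

embed-id : ∀ {n} (A : Simple n) → embed id A ≡ ⌜ A ⌝
embed-id (var x) = refl
embed-id (A ⇒ B) = cong₂ _⇒_ (embed-id A) (embed-id B)

-- Naming `A` itself gives `(A ⇒ x) ⇒ x` with `x` fresh and quantified: a state with one item, no
-- clauses and goal `x`. By soundness the closed term forces `A` everywhere, so the item yields `x`.
closure-inhabited : ∀ {n} (A : Simple n) → Inhabited A → LinearTy ⌜ A ⌝ → ∀-closure ⌜ A ⌝ ≡Y 𝟙
closure-inhabited A t lin = ≡Y-trans
  (closure-cong (≡Y-sym (name⁺ ⌜ A ⌝ (var zero) (subst WF (embed-id A) (WF-embed id A))
      (var zero) refl)))
  (subst (λ T → ∀-closure ((T ⇒ var zero) ⇒ var zero) ≡Y 𝟙) (sym weaken≡)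
    (closure-state (size A + 0) suc (pos A zero ∷ []) [] zero ℕ.≤-refl
      (subst (λ T → LinearTy ((T ⇒ var zero) ⇒ var zero)) weaken≡ lin′)
      λ where F V m (h ∷ []) [] w → h (Semantics.sound F (m ∘ suc) t [])))
  where
  weaken≡ : weaken ⌜ A ⌝ ≡ embed suc A
  weaken≡ = trans (cong weaken (sym (embed-id A))) (weaken-embed id A)
  lin′ : LinearTy ((weaken ⌜ A ⌝ ⇒ var zero) ⇒ var zero)
  lin′ zero    rewrite occ-weaken-zero Sign.- ⌜ A ⌝ = ℕ.≤-refl
  lin′ (suc x) rewrite occ-weaken Sign.- x ⌜ A ⌝ | ℕ.+-identityʳ (occ Sign.- x ⌜ A ⌝)
      | ℕ.+-identityʳ (occ Sign.- x ⌜ A ⌝) = lin x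

proposition3p1 : ∀ (n : ℕ) (A : Simple n) → (∀ x → Occurs x ⌜ A ⌝) → Inhabited A →
    Balanced A ⊎ NegativelyNonDuplicated A →
    ∀-closure ⌜ A ⌝ ≡Y 𝟙
-- Every variable in scope occurs in `A`, so balance gives it exactly one negative occurrence.
proposition3p1 n A occurs t (inj₁ bal) =
  closure-inhabited A t λ x → ℕ.≤-reflexive (proj₂ (bal x (occurs x)))
proposition3p1 n A occurs t (inj₂ nnd) = closure-inhabited A t nnd
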